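{- Let $\Lambda$ be an extended metric space with a monoid structure $(\Lambda,*,0)$ such that $d_\Lambda(\alpha*\beta,\alpha'*\beta')\le d_\Lambda(\alpha,\alpha')+d_\Lambda(\beta,\beta')$ for all $\alpha,\alpha',\beta,\beta'\in\Lambda$, let $\mathcal{W}$ be the quantitative theory of writing computations of type $\Lambda$, and let $\mathcal{U}$ be a basic quantitative equational theory (of a type disjoint from that of $\mathcal{W}$). Then $T_{\mathcal{U}}(\Lambda\,\square\,-)$, with its canonical composite monad structure, is the free monad on the theory $\mathcal{U}\otimes\mathcal{W}$ in $\mathbf{Met}$; i.e. it is isomorphic as a monad to $T_{\mathcal{U}\otimes\mathcal{W}}$.
   Context: An extended metric space is a set $X$ with $d_X:X\times X\to[0,\infty]$ satisfying $d_X(x,y)=0$ iff $x=y$, symmetry and the triangle inequality. $\mathbf{Met}$ is the category of extended metric spaces and non-expansive maps. Quantitative theories. A signature $\Sigma$ is a set of function symbols $f:n$ of finite arity $n\in\mathbb{N}$. Fix a countably infinite set of variables $V$; terms are $\Sigma$-terms over $V$. A quantitative equation is an expression $t=_\varepsilon s$ with $t,s$ terms and $\varepsilon\in\mathbb{Q}_{\ge0}$. A conditional quantitative equation is $\Gamma\vdash t=_\varepsilon s$ with $\Gamma$ a finite set of quantitative equations. A quantitative equational theory of type $\Sigma$ is a set $\mathcal{U}$ of conditional quantitative equations containing (for all variables and rationals $\varepsilon,\varepsilon'\ge 0$) $\vdash x=_0x$; $\{x=_\varepsilon y\}\vdash y=_\varepsilon x$; $\{x=_\varepsilon z,z=_{\varepsilon'}y\}\vdash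 x=_{\varepsilon+\varepsilon'}y$; $\{x=_\varepsilon y\}\vdash x=_{\varepsilon+\varepsilon'}y$ for $\varepsilon'>0$; $\{x_i=_\varepsilon y_i\mid i=1,\dots,n\}\vdash f(x_1,\dots,x_n)=_\varepsilon f(y_1,\dots,y_n)$ for $f:n\in\Sigma$; and closed under: continuity (if $\Gamma\vdash t=_{\varepsilon'}s\in\mathcal{U}$ for all $\varepsilon'>\varepsilon$ then $\Gamma\vdash t=_\varepsilon s\in\mathcal{U}$), substitution of terms for variables, assumption ($\Gamma\vdash\phi\in\mathcal{U}$ whenever $\phi\in\Gamma$), and cut (if $\Gamma\vdash\phi\in\mathcal{U}$ for all $\phi\in\Theta$ and $\Theta\vdash\psi\in\mathcal{U}$ then $\Gamma\vdash\psi\in\mathcal{U}$). A set $A$ of conditional quantitative equations axiomatizes $\mathcal{U}$ if $\mathcal{U}$ is the smallest theory containing $A$. $\mathcal{U}$ is basic if it is axiomatized by a set of conditional quantitative equations of the form $\{x_1=_{\varepsilon_1}y_1,\dots,x_n=_{\varepsilon_n}y_n\}\vdash t=_\varepsilon s$ with all $x_i,y_i$ variables. Models. A quantitative $\Sigma$-algebra is an extended metric space $A$ with, for each $f:n\in\Sigma$, a map $f^A:A^n\to A$ that is non-expansive for the max metric on $A^n$. It satisfies $\Gamma\vdash t=_\varepsilon s$ if for every assignment $\iota:V\to A$ (extended homomorphically to terms), $d_A(\iota(t'),\iota(s'))\le\varepsilon'$ for all $t'=_{\varepsilon'}s'\in\Gamma$ implies $d_A(\iota(t),\iota(s))\le\varepsilon$.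 $\mathbb{K}(\Sigma,\mathcal{U})$ is the category of quantitative $\Sigma$-algebras satisfying all members of $\mathcal{U}$, with non-expansive $\Sigma$-homomorphisms. The forgetful functor $\mathbb{K}(\Sigma,\mathcal{U})\to\mathbf{Met}$ has a left adjoint (known result); $T_{\mathcal{U}}$ denotes the induced monad on $\mathbf{Met}$, called the free monad on $\mathcal{U}$. Tensor of theories. For theories of disjoint types $\Sigma,\Sigma'$, $\mathcal{U}\otimes\mathcal{U}'$ is the smallest quantitative equational theory of type $\Sigma\cup\Sigma'$ containing $\mathcal{U}$, $\mathcal{U}'$ and, for all $f:n\in\Sigma$ and $g:m\in\Sigma'$, the equation $$\vdash f(g(x^1_1,\dots,x^1_m),\dots,g(x^n_1,\dots,x^n_m))=_0 g(f(x^1_1,\dots,x^n_1),\dots,f(x^1_m,\dots,x^n_m)).$$ Writer theory. $\mathcal{W}$ has signature $\{\mathsf{w}_\alpha:1\mid\alpha\in\Lambda\}$ and is axiomatized by, for all $\alpha,\alpha'\in\Lambda$: $\vdash x=_0\mathsf{w}_0(x)$; $\ \vdash\mathsf{w}_\alpha(\mathsf{w}_{\alpha'}(x))=_0\mathsf{w}_{\alpha*\alpha'}(x)$; $\ \{x=_\varepsilon x'\}\vdash\mathsf{w}_\alpha(x)=_\delta\mathsf{w}_{\alpha'}(x')$ for all $\varepsilon,\delta\in\mathbb{Q}_{\ge0}$ with $\delta\ge d_\Lambda(\alpha,\alpha')+\varepsilon$. Composite monad. $X\square Y$ is $X\times Y$ with $d((x,y),(x',y'))=d_X(x,x')+d_Y(y,y')$.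 The writer monad $\Lambda\square-$ has unit $x\mapsto(0,x)$ and multiplication $\varsigma_X(\alpha,(\alpha',x))=(\alpha*\alpha',x)$. $T=T_{\mathcal{U}}$ (unit $\eta$, multiplication $\mu$) is strong for $\square$ with strength $t_{X,Y}(x,u)=T(y\mapsto(x,y))(u)$, and $t_{\Lambda,- }:\Lambda\square T-\Rightarrow T(\Lambda\square-)$ is a distributive law. The composite monad $T(\Lambda\square-)$ has unit $x\mapsto\eta(0,x)$ and multiplication $T\varsigma_X\circ\mu_{\Lambda\square(\Lambda\square X)}\circ T(t_{\Lambda,\Lambda\square X}):T(\Lambda\square T(\Lambda\square X))\to T(\Lambda\square X)$. -}

module Defs where

open import Algebra.Bundles using (CommutativeMonoid)
import Algebra.Properties.CommutativeSemigroup as CommutativeSemigroup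
open import Algebra.Structures using (IsMonoid)
open import Data.Fin.Base using (Fin; zero; suc)
open import Data.Irrelevant using ([_])
open import Data.List.Base using (List; []; _∷_; map; tabulate)
open import Data.List.Membership.Propositional using (_∈_)
open import Data.List.Relation.Unary.Any using (here; there)
open import Data.Nat.Base using (ℕ)
open import Data.Product.Base using (_×_; _,_; proj₁; proj₂; ∃-syntax; Σ-syntax)
open import Data.Rational.Base as ℚ using (ℚ; 0ℚ)
import Data.Rational.Properties as ℚ
import Data.Refinement as Refinement
open import Data.Sum.Base using (_⊎_; inj₁; inj₂)
open import Data.Vec.Base as Vec using (Vec; []; _∷_; lookup)
open import Data.Vec.Functional using (Vector)
open import Data.Vec.Properties
  using (lookup∘tabulate; tabulate∘lookup; tabulate-cong)
open import Function.Base using (_∘_; id)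
open import Level as Level using (Level; _⊔_; Lift; lift; lower)
open import Relation.Binary.Bundles using (Setoid)
open import Relation.Binary.Definitions using (tri<; tri≈; tri>)
open import Relation.Binary.PropositionalEquality
  using (_≡_; refl; sym; trans; cong; subst; subst₂)
import Relation.Binary.Reasoning.Setoid as SetoidReasoning
open import Relation.Nullary.Decidable using (recompute)
open import Relation.Unary using (Pred; _⊆_)

private
  variable
    ℓ : Level

ℚ≥0 : Set
ℚ≥0 = Refinement.Refinement ℚ (0ℚ ℚ.≤_)

open Refinement using (value)

infix 4 _≤_ _<_
infixl 6 _+_

_≤_ _<_ : ℚ≥0 → ℚ≥0 → Set
ε ≤ δ = value ε ℚ.≤ value δ
ε < δ = value ε ℚ.< value δ

0q : ℚ≥0
0q = 0ℚ Refinement., [ ℚ.≤-refl ]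

_+_ : ℚ≥0 → ℚ≥0 → ℚ≥0
(p Refinement., [ 0≤p ]) + (q Refinement., [ 0≤q ]) =
  (p ℚ.+ q) Refinement., [ ℚ.+-mono-≤ 0≤p 0≤q ]

abstract
  0≤ : ∀ ε → 0q ≤ ε
  0≤ (p Refinement., [ 0≤p ]) = recompute (0ℚ ℚ.≤? p) 0≤p

  +-identityˡ : ∀ ε → 0q + ε ≡ ε
  +-identityˡ ε = Refinement.value-injective (ℚ.+-identityˡ (value ε))

  ε≤ε+δ : ∀ ε δ → ε ≤ ε + δ
  ε≤ε+δ ε δ = subst (ℚ._≤ value (ε + δ)) (ℚ.+-identityʳ (value ε))
    (ℚ.+-mono-≤ (ℚ.≤-refl {value ε}) (0≤ δ))

  δ≤ε+δ : ∀ ε δ → δ ≤ ε + δ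
  δ≤ε+δ ε δ = subst (ℚ._≤ value (ε + δ)) (ℚ.+-identityˡ (value δ))
    (ℚ.+-mono-≤ (0≤ ε) (ℚ.≤-refl {value δ}))

  <-dense : ∀ {ε δ} → ε < δ → ∃[ η ] (ε < η × η < δ)
  <-dense {ε} {δ} ε<δ with ℚ.<-dense ε<δ
  ... | q , ε<q , q<δ =
    (q Refinement., [ ℚ.≤-trans (0≤ ε) (ℚ.<⇒≤ ε<q) ]) , ε<q , q<δ

  <-split : ∀ ε δ → ε < δ → ∃[ η ] (0q < η × ε + η ≡ δ)
  <-split ε δ ε<δ =
      ((value δ ℚ.- value ε) Refinement., [ ℚ.<⇒≤ 0<η ])
    , 0<η
    , Refinement.value-injective ε+η≡δ
    where
    0<η : 0ℚ ℚ.< value δ ℚ.- value ε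
    0<η = subst (ℚ._< value δ ℚ.- value ε) (ℚ.+-inverseʳ (value ε))
      (ℚ.+-monoˡ-< (ℚ.- value ε) ε<δ)

    ε+η≡δ : value ε ℚ.+ (value δ ℚ.- value ε) ≡ value δ
    ε+η≡δ = trans (ℚ.+-comm (value ε) (value δ ℚ.- value ε))
      (trans (ℚ.+-assoc (value δ) (ℚ.- value ε) (value ε))
        (trans (cong (value δ ℚ.+_) (ℚ.+-inverseˡ (value ε)))
          (ℚ.+-identityʳ (value δ))))

  ≤-split : ∀ ε δ → ε ≤ δ → ε ≡ δ ⊎ (∃[ η ] (0q < η × ε + η ≡ δ))
  ≤-split ε δ ε≤δ with ℚ.<-cmp (value ε) (value δ)
  ... | tri≈ _ ε≡δ _ = inj₁ (Refinement.value-injective ε≡δ)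
  ... | tri> _ _ δ<ε with () ← ℚ.<-irrefl refl (ℚ.<-≤-trans δ<ε ε≤δ)
  ... | tri< ε<δ _ _ = inj₂ (<-split ε δ ε<δ)

  <-+ : ∀ ε η → 0q < η → ε < ε + η
  <-+ ε η 0<η = subst (ℚ._< value (ε + η)) (ℚ.+-identityʳ (value ε))
    (ℚ.+-mono-≤-< (ℚ.≤-refl {value ε}) 0<η)

-- An extended non-negative real r, as an upper Dedekind cut: r is given by
-- the set { ε ∈ ℚ≥0 ∣ r ≤ ε }, which is upward closed and contains its
-- rational infimum (if any). The empty set is ∞.

record [0,∞] (ℓ : Level) : Set (Level.suc ℓ) where
  field
    bound  : Pred ℚ≥0 ℓ
    upward : ∀ {ε δ} → ε ≤ δ → bound ε → bound δ
    closed : ∀ {ε} → (∀ δ → ε < δ → bound δ) → bound ε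

open [0,∞]

infix 4 _≼_ _≤∞_ _≈∞_
infixl 6 _+∞_

_≼_ : [0,∞] ℓ → ℚ≥0 → Set ℓ
r ≼ ε = bound r ε

_≤∞_ _≈∞_ : [0,∞] ℓ → [0,∞] ℓ → Set ℓ
r ≤∞ s = ∀ ε → s ≼ ε → r ≼ ε
r ≈∞ s = (r ≤∞ s) × (s ≤∞ r)

fromℚ≥0 : ℚ≥0 → [0,∞] ℓ
bound  (fromℚ≥0 {ℓ} η) ε = Lift ℓ (η ≤ ε)
upward (fromℚ≥0 η) ε≤δ (lift η≤ε) = lift (ℚ.≤-trans η≤ε ε≤δ)
closed (fromℚ≥0 η) {ε} η≤δ = lift (ℚ.≮⇒≥ λ ε<η →
  let δ , ε<δ , δ<η = <-dense {ε} {η} ε<η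
  in ℚ.<-irrefl refl (ℚ.<-≤-trans δ<η (lower (η≤δ δ ε<δ))))

0∞ : [0,∞] ℓ
0∞ = fromℚ≥0 0q

-- r + s = inf { α + β ∣ r ≤ α, s ≤ β }
_+∞_ : [0,∞] ℓ → [0,∞] ℓ → [0,∞] ℓ
bound  (r +∞ s) ε = ∀ δ → ε < δ → ∃[ α ] ∃[ β ] (r ≼ α × s ≼ β × α + β ≤ δ)
upward (r +∞ s) ε≤ε′ b δ ε′<δ = b δ (ℚ.≤-<-trans ε≤ε′ ε′<δ)
closed (r +∞ s) {ε} b δ ε<δ =
  let δ′ , ε<δ′ , δ′<δ = <-dense {ε} {δ} ε<δ in b δ′ ε<δ′ δ δ′<δ

-- Finite maximum; the maximum of the empty family is 0.
max : ∀ {n} → Vector ([0,∞] ℓ) n → [0,∞] ℓ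
bound  (max r) ε = ∀ i → r i ≼ ε
upward (max r) ε≤δ b i = upward (r i) ε≤δ (b i)
closed (max r) b i = closed (r i) (λ δ ε<δ → b δ ε<δ i)

abstract
  ≼-+ : ∀ (r s : [0,∞] ℓ) {α β} → r ≼ α → s ≼ β → (r +∞ s) ≼ (α + β)
  ≼-+ r s {α} {β} rα sβ δ α+β<δ = α , β , rα , sβ , ℚ.<⇒≤ α+β<δ

  +∞-0ˡ : ∀ (r s : [0,∞] ℓ) → (r +∞ s) ≼ 0q → r ≼ 0q
  +∞-0ˡ r s b = closed r λ δ 0<δ →
    let α , β , rα , _ , α+β≤δ = b δ 0<δ
    in upward r (ℚ.≤-trans (ε≤ε+δ α β) α+β≤δ) rα

  +∞-0ʳ : ∀ (r s : [0,∞] ℓ) → (r +∞ s) ≼ 0q → s ≼ 0q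
  +∞-0ʳ r s b = closed s λ δ 0<δ →
    let α , β , _ , sβ , α+β≤δ = b δ 0<δ
    in upward s (ℚ.≤-trans (δ≤ε+δ α β) α+β≤δ) sβ

  ≤∞-trans : ∀ (r s t : [0,∞] ℓ) → r ≤∞ s → s ≤∞ t → r ≤∞ t
  ≤∞-trans r s t p q ε = p ε ∘ q ε

  +∞-mono : ∀ (r r′ s s′ : [0,∞] ℓ) →
    r ≤∞ r′ → s ≤∞ s′ → r +∞ s ≤∞ r′ +∞ s′
  +∞-mono r r′ s s′ p q ε b δ ε<δ =
    let α , β , rα , sβ , α+β≤δ = b δ ε<δ
    in α , β , p α rα , q β sβ , α+β≤δ

  +∞-identityˡ-≤ : ∀ (r s : [0,∞] ℓ) → r ≼ 0q → r +∞ s ≤∞ s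
  +∞-identityˡ-≤ r s r≼0 ε sε =
    subst (r +∞ s ≼_) (+-identityˡ ε) (≼-+ r s r≼0 sε)

  +-interchange : ∀ α β γ δ → value ((α + β) + (γ + δ)) ≡ value ((α + γ) + (β + δ))
  +-interchange α β γ δ = CommutativeSemigroup.interchange
    (CommutativeMonoid.commutativeSemigroup ℚ.+-0-commutativeMonoid)
    (value α) (value β) (value γ) (value δ)

  +∞-interchange : ∀ (r s t u : [0,∞] ℓ) →
    (r +∞ t) +∞ (s +∞ u) ≤∞ (r +∞ s) +∞ (t +∞ u)
  +∞-interchange r s t u ε b =
    closed ((r +∞ t) +∞ (s +∞ u)) {ε} λ δ ε<δ →
    let γ , ε<γ , γ<δ = <-dense {ε} {δ} ε<δ
        α , β , rsα , tuβ , α+β≤γ = b γ ε<γ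
        η , γ<η , η<δ = <-dense {γ} {δ} γ<δ
        θ , 0<θ , γ+θ≡η = <-split γ η γ<η
        κ , 0<κ , η+κ≡δ = <-split η δ η<δ
        α₁ , α₂ , rα₁ , sα₂ , α₁+α₂≤ = rsα (α + θ) (<-+ α θ 0<θ)
        β₁ , β₂ , tβ₁ , uβ₂ , β₁+β₂≤ = tuβ (β + κ) (<-+ β κ 0<κ)
        open ℚ.≤-Reasoning
    in upward ((r +∞ t) +∞ (s +∞ u)) {(α₁ + β₁) + (α₂ + β₂)} {δ}
         (begin
           value ((α₁ + β₁) + (α₂ + β₂)) ≡⟨ +-interchange α₁ β₁ α₂ β₂ ⟩
           value ((α₁ + α₂) + (β₁ + β₂)) ≤⟨ ℚ.+-mono-≤ α₁+α₂≤ β₁+β₂≤ ⟩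
           value ((α + θ) + (β + κ))     ≡⟨ +-interchange α θ β κ ⟩
           value ((α + β) + (θ + κ))     ≤⟨ ℚ.+-mono-≤ α+β≤γ (ℚ.≤-refl {value (θ + κ)}) ⟩
           value (γ + (θ + κ))           ≡⟨ ℚ.+-assoc (value γ) (value θ) (value κ) ⟨
           value ((γ + θ) + κ)           ≡⟨ cong (λ ξ → value (ξ + κ)) γ+θ≡η ⟩
           value (η + κ)                 ≡⟨ cong value η+κ≡δ ⟩
           value δ                       ∎)
         (≼-+ (r +∞ t) (s +∞ u) {α₁ + β₁} {α₂ + β₂}
           (≼-+ r t rα₁ tβ₁) (≼-+ s u sα₂ uβ₂))

  +∞-assoc-≤ : ∀ (r s t : [0,∞] ℓ) → (r +∞ s) +∞ t ≤∞ r +∞ (s +∞ t)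
  +∞-assoc-≤ r s t ε b =
    closed ((r +∞ s) +∞ t) {ε} λ δ ε<δ →
    let γ , ε<γ , γ<δ = <-dense {ε} {δ} ε<δ
        α , β , rα , stβ , α+β≤γ = b γ ε<γ
        θ , 0<θ , γ+θ≡δ = <-split γ δ γ<δ
        β₁ , β₂ , sβ₁ , tβ₂ , β₁+β₂≤ = stβ (β + θ) (<-+ β θ 0<θ)
        open ℚ.≤-Reasoning
    in upward ((r +∞ s) +∞ t) {(α + β₁) + β₂} {δ}
         (begin
           value ((α + β₁) + β₂) ≡⟨ ℚ.+-assoc (value α) (value β₁) (value β₂) ⟩
           value (α + (β₁ + β₂)) ≤⟨ ℚ.+-mono-≤ (ℚ.≤-refl {value α}) β₁+β₂≤ ⟩
           value (α + (β + θ))   ≡⟨ ℚ.+-assoc (value α) (value β) (value θ) ⟨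
           value ((α + β) + θ)   ≤⟨ ℚ.+-mono-≤ α+β≤γ (ℚ.≤-refl {value θ}) ⟩
           value (γ + θ)         ≡⟨ cong value γ+θ≡δ ⟩
           value δ               ∎)
         (≼-+ (r +∞ s) t {α + β₁} {β₂} (≼-+ r s rα sβ₁) tβ₂)

  ≼0⇒≈0 : ∀ (r : [0,∞] ℓ) → r ≼ 0q → r ≈∞ 0∞
  ≼0⇒≈0 r r≼0 = (λ ε 0≤ε → upward r (lower 0≤ε) r≼0) , (λ ε _ → lift (0≤ ε))

-- An extended metric space; its underlying set is a setoid, since free
-- models are quotients of terms.

record Met (ℓ : Level) : Set (Level.suc ℓ) where
  field
    setoid : Setoid ℓ ℓ

  open Setoid setoid public
    using (Carrier; _≈_; isEquivalence)
    renaming (refl to ≈-refl; sym to ≈-sym; trans to ≈-trans)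

  field
    d          : Carrier → Carrier → [0,∞] ℓ
    d≈0⇒≈      : ∀ {x y} → d x y ≈∞ 0∞ → x ≈ y
    ≈⇒d≈0      : ∀ {x y} → x ≈ y → d x y ≈∞ 0∞
    d-sym      : ∀ x y → d x y ≈∞ d y x
    d-triangle : ∀ x y z → d x y ≤∞ d x z +∞ d z y

  d≼0⇒≈ : ∀ {x y} → d x y ≼ 0q → x ≈ y
  d≼0⇒≈ {x} {y} = d≈0⇒≈ ∘ ≼0⇒≈0 (d x y)

  ≈⇒d≼ : ∀ {x y} ε → x ≈ y → d x y ≼ ε
  ≈⇒d≼ ε x≈y = proj₁ (≈⇒d≈0 x≈y) ε (lift (0≤ ε))

  d-sym≼ : ∀ x y {ε} → d x y ≼ ε → d y x ≼ ε
  d-sym≼ x y {ε} = proj₂ (d-sym x y) ε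

  triangle≼ : ∀ x z y {α β} → d x z ≼ α → d z y ≼ β → d x y ≼ (α + β)
  triangle≼ x z y {α} {β} p q =
    d-triangle x y z (α + β) (≼-+ (d x z) (d z y) p q)

  d-resp : ∀ {x x′ y y′} ε → x ≈ x′ → y ≈ y′ → d x y ≼ ε → d x′ y′ ≼ ε
  d-resp {x} {x′} {y} {y′} ε x≈x′ y≈y′ p =
    subst (d x′ y′ ≼_) (+-identityˡ ε)
      (triangle≼ x′ x y′ (≈⇒d≼ 0q (≈-sym x≈x′))
        (subst (d x y′ ≼_) (trans (+-comm′ ε) (+-identityˡ ε))
          (triangle≼ x y y′ p (≈⇒d≼ 0q y≈y′))))
    where
    +-comm′ : ∀ ε → ε + 0q ≡ 0q + ε
    +-comm′ ε = Refinement.value-injective (ℚ.+-comm (value ε) 0ℚ)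

∣_∣ : Met ℓ → Set ℓ
∣_∣ = Met.Carrier

infixr 1 _⇒_
record _⇒_ (X Y : Met ℓ) : Set ℓ where
  private
    module X = Met X
    module Y = Met Y
  field
    to           : ∣ X ∣ → ∣ Y ∣
    nonexpansive : ∀ x y → Y.d (to x) (to y) ≤∞ X.d x y

  to-cong : ∀ {x y} → x X.≈ y → to x Y.≈ to y
  to-cong {x} {y} x≈y = Y.d≼0⇒≈ (nonexpansive x y 0q (X.≈⇒d≼ 0q x≈y))

open _⇒_ public

infix 4 _≗_
_≗_ : {X Y : Met ℓ} → (f g : X ⇒ Y) → Set ℓ
_≗_ {X = X} {Y} f g = ∀ x → Met._≈_ Y (to f x) (to g x)

idM : (X : Met ℓ) → X ⇒ X
to           (idM X) = id
nonexpansive (idM X) x y ε p = p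

infixr 9 _∙_
_∙_ : {X Y Z : Met ℓ} → Y ⇒ Z → X ⇒ Y → X ⇒ Z
to           (g ∙ f) = to g ∘ to f
nonexpansive (g ∙ f) x y ε p =
  nonexpansive g (to f x) (to f y) ε (nonexpansive f x y ε p)

-- X ^ n carries the max metric.
infixl 8 _^_
_^_ : Met ℓ → ℕ → Met ℓ
X ^ n = record
  { setoid = record
    { Carrier = Vector ∣ X ∣ n
    ; _≈_ = λ x y → ∀ i → x i ≈ y i
    ; isEquivalence = record
      { refl  = λ i → ≈-refl
      ; sym   = λ p i → ≈-sym (p i)
      ; trans = λ p q i → ≈-trans (p i) (q i)
      }
    }
  ; d = λ x y → max (λ i → d (x i) (y i))
  ; d≈0⇒≈ = λ p i → d≼0⇒≈ (proj₁ p 0q (lift ℚ.≤-refl) i)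
  ; ≈⇒d≈0 = λ {x} {y} p →
      ≼0⇒≈0 (max λ i → d (x i) (y i)) (λ i → ≈⇒d≼ 0q (p i))
  ; d-sym = λ x y → (λ ε p i → proj₁ (d-sym (x i) (y i)) ε (p i))
                  , (λ ε p i → proj₂ (d-sym (x i) (y i)) ε (p i))
  ; d-triangle = λ x y z ε p i → d-triangle (x i) (y i) (z i) ε λ δ ε<δ →
      let α , β , pα , pβ , α+β≤δ = p δ ε<δ in α , β , pα i , pβ i , α+β≤δ
  }
  where open Met X

infixr 7 _□_
_□_ : Met ℓ → Met ℓ → Met ℓ
X □ Y = record
  { setoid = record
    { Carrier = ∣ X ∣ × ∣ Y ∣
    ; _≈_ = λ (x , y) (x′ , y′) → x X.≈ x′ × y Y.≈ y′
    ; isEquivalence = record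
      { refl  = X.≈-refl , Y.≈-refl
      ; sym   = λ (p , q) → X.≈-sym p , Y.≈-sym q
      ; trans = λ (p , q) (p′ , q′) → X.≈-trans p p′ , Y.≈-trans q q′
      }
    }
  ; d = dist
  ; d≈0⇒≈ = λ {(x , y)} {(x′ , y′)} p →
      let p0 = proj₁ p 0q (lift ℚ.≤-refl)
      in X.d≼0⇒≈ (+∞-0ˡ (X.d x x′) (Y.d y y′) p0)
       , Y.d≼0⇒≈ (+∞-0ʳ (X.d x x′) (Y.d y y′) p0)
  ; ≈⇒d≈0 = λ {u} {v} (p , q) → ≼0⇒≈0 (dist u v)
      λ δ 0<δ → 0q , 0q , X.≈⇒d≼ 0q p , Y.≈⇒d≼ 0q q , ℚ.<⇒≤ 0<δ
  ; d-sym = λ u v → dist-sym v u , dist-sym u v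
  ; d-triangle = λ (x , y) (x′ , y′) (x″ , y″) →
      ≤∞-trans (X.d x x′ +∞ Y.d y y′)
        ((X.d x x″ +∞ X.d x″ x′) +∞ (Y.d y y″ +∞ Y.d y″ y′))
        ((X.d x x″ +∞ Y.d y y″) +∞ (X.d x″ x′ +∞ Y.d y″ y′))
        (+∞-mono (X.d x x′) (X.d x x″ +∞ X.d x″ x′)
          (Y.d y y′) (Y.d y y″ +∞ Y.d y″ y′)
          (X.d-triangle x x′ x″) (Y.d-triangle y y′ y″))
        (+∞-interchange (X.d x x″) (Y.d y y″) (X.d x″ x′) (Y.d y″ y′))
  }
  where
  module X = Met X
  module Y = Met Y

  dist : ∣ X ∣ × ∣ Y ∣ → ∣ X ∣ × ∣ Y ∣ → [0,∞] _
  dist (x , y) (x′ , y′) = X.d x x′ +∞ Y.d y y′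

  dist-sym : ∀ u v → dist v u ≤∞ dist u v
  dist-sym (x , y) (x′ , y′) ε p δ ε<δ =
    let α , β , pα , pβ , α+β≤δ = p δ ε<δ
    in α , β , X.d-sym≼ x x′ pα , Y.d-sym≼ y y′ pβ , α+β≤δ

record Monad (ℓ : Level) : Set (Level.suc ℓ) where
  field
    T₀ : Met ℓ → Met ℓ
    T₁ : ∀ {X Y} → X ⇒ Y → T₀ X ⇒ T₀ Y
    η  : ∀ X → X ⇒ T₀ X
    μ  : ∀ X → T₀ (T₀ X) ⇒ T₀ X

    T₁-cong : ∀ {X Y} {f g : X ⇒ Y} → f ≗ g → T₁ f ≗ T₁ g
    T₁-id   : ∀ X → T₁ (idM X) ≗ idM (T₀ X)
    T₁-∙    : ∀ {X Y Z} (g : Y ⇒ Z) (f : X ⇒ Y) → T₁ (g ∙ f) ≗ T₁ g ∙ T₁ f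

    η-natural : ∀ {X Y} (f : X ⇒ Y) → T₁ f ∙ η X ≗ η Y ∙ f
    μ-natural : ∀ {X Y} (f : X ⇒ Y) → T₁ f ∙ μ X ≗ μ Y ∙ T₁ (T₁ f)
    identityˡ : ∀ X → μ X ∙ η (T₀ X) ≗ idM (T₀ X)
    identityʳ : ∀ X → μ X ∙ T₁ (η X) ≗ idM (T₀ X)
    assoc     : ∀ X → μ X ∙ T₁ (μ X) ≗ μ X ∙ μ (T₀ X)

record _≅_ (S T : Monad ℓ) : Set (Level.suc ℓ) where
  private
    module S = Monad S
    module T = Monad T
  field
    φ   : ∀ X → S.T₀ X ⇒ T.T₀ X
    φ⁻¹ : ∀ X → T.T₀ X ⇒ S.T₀ X

    inverseˡ : ∀ X → φ X ∙ φ⁻¹ X ≗ idM (T.T₀ X)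
    inverseʳ : ∀ X → φ⁻¹ X ∙ φ X ≗ idM (S.T₀ X)

    natural     : ∀ {X Y} (f : X ⇒ Y) → φ Y ∙ S.T₁ f ≗ T.T₁ f ∙ φ X
    preserves-η : ∀ X → φ X ∙ S.η X ≗ T.η X
    preserves-μ : ∀ X → φ X ∙ S.μ X ≗ T.μ X ∙ (φ (T.T₀ X) ∙ S.T₁ (φ X))

infix 4 _≅_

record DistributiveLaw (S T : Monad ℓ) : Set (Level.suc ℓ) where
  private
    module S = Monad S
    module T = Monad T
  field
    law     : ∀ X → S.T₀ (T.T₀ X) ⇒ T.T₀ (S.T₀ X)
    natural : ∀ {X Y} (f : X ⇒ Y) →
      T.T₁ (S.T₁ f) ∙ law X ≗ law Y ∙ S.T₁ (T.T₁ f)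
    law-Sη  : ∀ X → law X ∙ S.η (T.T₀ X) ≗ T.T₁ (S.η X)
    law-Tη  : ∀ X → law X ∙ S.T₁ (T.η X) ≗ T.η (S.T₀ X)
    law-Sμ  : ∀ X → law X ∙ S.μ (T.T₀ X)
      ≗ T.T₁ (S.μ X) ∙ (law (S.T₀ X) ∙ S.T₁ (law X))
    law-Tμ  : ∀ X → law X ∙ S.T₁ (T.μ X)
      ≗ T.μ (S.T₀ X) ∙ (T.T₁ (law X) ∙ law (T.T₀ X))

composite : (S T : Monad ℓ) → DistributiveLaw S T → Monad ℓ
composite S T D = record
  { T₀ = λ X → T.T₀ (S.T₀ X)
  ; T₁ = λ f → T.T₁ (S.T₁ f)
  ; η  = η′
  ; μ  = μ′
  ; T₁-cong = λ p → T.T₁-cong (S.T₁-cong p)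
  ; T₁-id = λ X u → ≈-trans (T.T₀ (S.T₀ X)) (T.T₁-cong (S.T₁-id X) u)
      (T.T₁-id (S.T₀ X) u)
  ; T₁-∙ = λ {X} {Y} {Z} g f u → ≈-trans (T.T₀ (S.T₀ Z))
      (T.T₁-cong (S.T₁-∙ g f) u) (T.T₁-∙ (S.T₁ g) (S.T₁ f) u)
  ; η-natural = λ {X} {Y} f x → ≈-trans (T.T₀ (S.T₀ Y))
      (T.η-natural (S.T₁ f) (to (S.η X) x))
      (to-cong (T.η (S.T₀ Y)) (S.η-natural f x))
  ; μ-natural = μ-natural
  ; identityˡ = identityˡ
  ; identityʳ = identityʳ
  ; assoc = assoc
  }
  where
  module S = Monad S
  module T = Monad T
  open DistributiveLaw D
  open Met using (≈-trans)

  η′ : ∀ X → X ⇒ T.T₀ (S.T₀ X)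
  η′ X = T.η (S.T₀ X) ∙ S.η X

  μ′ : ∀ X → T.T₀ (S.T₀ (T.T₀ (S.T₀ X))) ⇒ T.T₀ (S.T₀ X)
  μ′ X = T.T₁ (S.μ X) ∙ (T.μ (S.T₀ (S.T₀ X)) ∙ T.T₁ (law (S.T₀ X)))

  T-square : ∀ {X Y Y′ Z} (g : Y ⇒ Z) (f : X ⇒ Y) (g′ : Y′ ⇒ Z) (f′ : X ⇒ Y′) →
    g ∙ f ≗ g′ ∙ f′ → T.T₁ g ∙ T.T₁ f ≗ T.T₁ g′ ∙ T.T₁ f′
  T-square {Z = Z} g f g′ f′ p u = begin
    to (T.T₁ g) (to (T.T₁ f) u)   ≈⟨ T.T₁-∙ g f u ⟨
    to (T.T₁ (g ∙ f)) u           ≈⟨ T.T₁-cong p u ⟩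
    to (T.T₁ (g′ ∙ f′)) u         ≈⟨ T.T₁-∙ g′ f′ u ⟩
    to (T.T₁ g′) (to (T.T₁ f′) u) ∎
    where open SetoidReasoning (Met.setoid (T.T₀ Z))

  μ-natural : ∀ {X Y} (f : X ⇒ Y) →
    T.T₁ (S.T₁ f) ∙ μ′ X ≗ μ′ Y ∙ T.T₁ (S.T₁ (T.T₁ (S.T₁ f)))
  μ-natural {X} {Y} f u = begin
    to (T.T₁ f₁) (to (T.T₁ (S.μ X)) (to (T.μ _) (to (T.T₁ (law _)) u)))
      ≈⟨ T-square f₁ (S.μ X) (S.μ Y) f₂ (S.μ-natural f) _ ⟩
    to (T.T₁ (S.μ Y)) (to (T.T₁ f₂) (to (T.μ _) (to (T.T₁ (law _)) u)))
      ≈⟨ to-cong (T.T₁ (S.μ Y)) (T.μ-natural f₂ _) ⟩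
    to (T.T₁ (S.μ Y)) (to (T.μ _) (to (T.T₁ (T.T₁ f₂)) (to (T.T₁ (law _)) u)))
      ≈⟨ to-cong (T.T₁ (S.μ Y) ∙ T.μ (S.T₀ (S.T₀ Y)))
           (T-square (T.T₁ f₂) (law _) (law _) (S.T₁ (T.T₁ f₁)) (natural f₁) u) ⟩
    to (μ′ Y) (to (T.T₁ (S.T₁ (T.T₁ f₁))) u) ∎
    where
    f₁ = S.T₁ f
    f₂ = S.T₁ f₁
    open SetoidReasoning (Met.setoid (T.T₀ (S.T₀ Y)))

  identityˡ : ∀ X → μ′ X ∙ η′ (T.T₀ (S.T₀ X)) ≗ idM (T.T₀ (S.T₀ X))
  identityˡ X u = begin
    to Tμ (to (T.μ _) (to (T.T₁ (law _)) (to (T.η _) (to (S.η _) u))))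
      ≈⟨ to-cong (Tμ ∙ T.μ _) (T.η-natural (law _) (to (S.η _) u)) ⟩
    to Tμ (to (T.μ _) (to (T.η _) (to (law _) (to (S.η _) u))))
      ≈⟨ to-cong Tμ (T.identityˡ _ _) ⟩
    to Tμ (to (law _) (to (S.η _) u))
      ≈⟨ to-cong Tμ (law-Sη (S.T₀ X) u) ⟩
    to Tμ (to (T.T₁ (S.η _)) u)
      ≈⟨ T-square (S.μ X) (S.η (S.T₀ X)) (idM _) (idM _) (S.identityˡ X) u ⟩
    to (T.T₁ (idM _)) (to (T.T₁ (idM _)) u)
      ≈⟨ T.T₁-id _ _ ⟩
    to (T.T₁ (idM _)) u
      ≈⟨ T.T₁-id _ u ⟩
    u ∎
    where
    Tμ = T.T₁ (S.μ X)
    open SetoidReasoning (Met.setoid (T.T₀ (S.T₀ X)))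

  identityʳ : ∀ X → μ′ X ∙ T.T₁ (S.T₁ (η′ X)) ≗ idM (T.T₀ (S.T₀ X))
  identityʳ X u = begin
    to Tμ (to (T.μ _) (to (T.T₁ (law _)) (to (T.T₁ (S.T₁ (η′ X))) u)))
      ≈⟨ to-cong (Tμ ∙ T.μ _)
           (T-square (law (S.T₀ X)) (S.T₁ (η′ X)) (T.η _) (S.T₁ (S.η X)) law-η′ u) ⟩
    to Tμ (to (T.μ _) (to (T.T₁ (T.η _)) (to (T.T₁ (S.T₁ (S.η X))) u)))
      ≈⟨ to-cong Tμ (T.identityʳ _ _) ⟩
    to Tμ (to (T.T₁ (S.T₁ (S.η X))) u)
      ≈⟨ T-square (S.μ X) (S.T₁ (S.η X)) (idM _) (idM _) (S.identityʳ X) u ⟩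
    to (T.T₁ (idM _)) (to (T.T₁ (idM _)) u)
      ≈⟨ T.T₁-id _ _ ⟩
    to (T.T₁ (idM _)) u
      ≈⟨ T.T₁-id _ u ⟩
    u ∎
    where
    Tμ = T.T₁ (S.μ X)
    law-η′ : law (S.T₀ X) ∙ S.T₁ (η′ X) ≗ T.η _ ∙ S.T₁ (S.η X)
    law-η′ v = ≈-trans (T.T₀ (S.T₀ (S.T₀ X)))
      (to-cong (law _) (S.T₁-∙ (T.η _) (S.η X) v)) (law-Tη (S.T₀ X) _)
    open SetoidReasoning (Met.setoid (T.T₀ (S.T₀ X)))

  assoc : ∀ X → μ′ X ∙ T.T₁ (S.T₁ (μ′ X)) ≗ μ′ X ∙ μ′ (T.T₀ (S.T₀ X))
  assoc X u = begin
    to Tμ (to (T.μ _) (to (T.T₁ (law SX)) (to (T.T₁ (S.T₁ (μ′ X))) u)))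
      ≈⟨ to-cong (Tμ ∙ T.μ _)
           (T-square (law SX) (S.T₁ (μ′ X)) (T.T₁ (S.T₁ (S.μ X))) m law-μ′ u) ⟩
    to Tμ (to (T.μ _) (to (T.T₁ (T.T₁ (S.T₁ (S.μ X)))) (to (T.T₁ m) u)))
      ≈⟨ to-cong Tμ (T.μ-natural (S.T₁ (S.μ X)) _) ⟨
    to Tμ (to (T.T₁ (S.T₁ (S.μ X))) (to (T.μ _) (to (T.T₁ m) u)))
      ≈⟨ T-square (S.μ X) (S.T₁ (S.μ X)) (S.μ X) (S.μ SX) (S.assoc X) _ ⟩
    to Tμ (to (T.T₁ (S.μ SX)) (to (T.μ _) (to (T.T₁ m) u)))
      ≈⟨ to-cong Tμ (T.μ-natural (S.μ SX) _) ⟩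
    to Tμ (to (T.μ _) (to (T.T₁ (T.T₁ (S.μ SX))) (to (T.T₁ m) u)))
      ≈⟨ to-cong (Tμ ∙ T.μ _)
           (T-square (T.T₁ (S.μ SX)) m (T.μ _) (T.T₁ w ∙ law STSX) m-w u) ⟩
    to Tμ (to (T.μ _) (to (T.T₁ (T.μ _)) (to (T.T₁ (T.T₁ w ∙ law STSX)) u)))
      ≈⟨ to-cong Tμ (T.assoc _ _) ⟩
    to Tμ (to (T.μ _) (to (T.μ _) (to (T.T₁ (T.T₁ w ∙ law STSX)) u)))
      ≈⟨ to-cong (Tμ ∙ (T.μ _ ∙ T.μ _)) (T.T₁-∙ (T.T₁ w) (law STSX) u) ⟩
    to Tμ (to (T.μ _) (to (T.μ _) (to (T.T₁ (T.T₁ w)) (to (T.T₁ (law STSX)) u))))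
      ≈⟨ to-cong (Tμ ∙ T.μ _) (T.μ-natural w _) ⟨
    to Tμ (to (T.μ _) (to (T.T₁ w) (to (T.μ _) (to (T.T₁ (law STSX)) u))))
      ≈⟨ to-cong (Tμ ∙ T.μ _) (T.T₁-cong (law-Sμ SX) _) ⟨
    to Tμ (to (T.μ _) (to (T.T₁ (law SX ∙ S.μ TSX)) (to (T.μ _) (to (T.T₁ (law STSX)) u))))
      ≈⟨ to-cong (Tμ ∙ T.μ _) (T.T₁-∙ (law SX) (S.μ TSX) _) ⟩
    to (μ′ X) (to (μ′ TSX) u) ∎
    where
    SX   = S.T₀ X
    TSX  = T.T₀ SX
    STSX = S.T₀ TSX
    Tμ   = T.T₁ (S.μ X)

    k : S.T₀ STSX ⇒ T.T₀ (S.T₀ (S.T₀ SX))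
    k = law (S.T₀ SX) ∙ S.T₁ (law SX)

    w : S.T₀ STSX ⇒ T.T₀ (S.T₀ SX)
    w = T.T₁ (S.μ SX) ∙ k

    m : S.T₀ (T.T₀ STSX) ⇒ T.T₀ (S.T₀ (S.T₀ SX))
    m = T.μ _ ∙ (T.T₁ k ∙ law STSX)

    law-μ′ : law SX ∙ S.T₁ (μ′ X) ≗ T.T₁ (S.T₁ (S.μ X)) ∙ m
    law-μ′ v = begin
      to (law SX) (to (S.T₁ (μ′ X)) v)
        ≈⟨ to-cong (law SX) (S.T₁-∙ Tμ _ v) ⟩
      to (law SX) (to (S.T₁ Tμ) (to (S.T₁ (T.μ _ ∙ T.T₁ (law SX))) v))
        ≈⟨ natural (S.μ X) _ ⟨
      to TSμ (to (law _) (to (S.T₁ (T.μ _ ∙ T.T₁ (law SX))) v))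
        ≈⟨ to-cong (TSμ ∙ law _) (S.T₁-∙ (T.μ _) (T.T₁ (law SX)) v) ⟩
      to TSμ (to (law _) (to (S.T₁ (T.μ _)) (to (S.T₁ (T.T₁ (law SX))) v)))
        ≈⟨ to-cong TSμ (law-Tμ _ _) ⟩
      to TSμ (to (T.μ _) (to (T.T₁ (law _)) (to (law _) (to (S.T₁ (T.T₁ (law SX))) v))))
        ≈⟨ to-cong (TSμ ∙ (T.μ _ ∙ T.T₁ (law _))) (natural (law SX) v) ⟨
      to TSμ (to (T.μ _) (to (T.T₁ (law _)) (to (T.T₁ (S.T₁ (law SX))) (to (law STSX) v))))
        ≈⟨ to-cong (TSμ ∙ T.μ _) (T.T₁-∙ (law _) (S.T₁ (law SX)) _) ⟨
      to TSμ (to m v) ∎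
      where
      TSμ = T.T₁ (S.T₁ (S.μ X))
      open SetoidReasoning (Met.setoid (T.T₀ (S.T₀ SX)))

    m-w : T.T₁ (S.μ SX) ∙ m ≗ T.μ _ ∙ (T.T₁ w ∙ law STSX)
    m-w v = begin
      to (T.T₁ (S.μ SX)) (to (T.μ _) (to (T.T₁ k) (to (law STSX) v)))
        ≈⟨ T.μ-natural (S.μ SX) _ ⟩
      to (T.μ _) (to (T.T₁ (T.T₁ (S.μ SX))) (to (T.T₁ k) (to (law STSX) v)))
        ≈⟨ to-cong (T.μ _) (T.T₁-∙ (T.T₁ (S.μ SX)) k _) ⟨
      to (T.μ _) (to (T.T₁ w) (to (law STSX) v)) ∎
      where open SetoidReasoning (Met.setoid (T.T₀ (S.T₀ SX)))

    open SetoidReasoning (Met.setoid TSX)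

record Signature (ℓ : Level) : Set (Level.suc ℓ) where
  field
    Op    : Set ℓ
    arity : Op → ℕ

open Signature

infixr 5 _⊎ˢ_
_⊎ˢ_ : Signature ℓ → Signature ℓ → Signature ℓ
Op    (S ⊎ˢ S′)          = Op S ⊎ Op S′
arity (S ⊎ˢ S′) (inj₁ f) = arity S f
arity (S ⊎ˢ S′) (inj₂ g) = arity S′ g

data Term {a} (S : Signature ℓ) (X : Set a) : Set (ℓ ⊔ a) where
  var : X → Term S X
  op  : (f : Op S) → Vec (Term S X) (arity S f) → Term S X

module _ {a b} {S : Signature ℓ} {X : Set a} {B : Set b}
  (alg : (f : Op S) → Vec B (arity S f) → B) (ι : X → B) where

  fold  : Term S X → B
  folds : ∀ {n} → Vec (Term S X) n → Vec B n

  fold (var x)   = ι x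
  fold (op f ts) = alg f (folds ts)

  folds []       = []
  folds (t ∷ ts) = fold t ∷ folds ts

  lookup-folds : ∀ {n} (ts : Vec (Term S X) n) i →
    lookup (folds ts) i ≡ fold (lookup ts i)
  lookup-folds (t ∷ ts) zero    = refl
  lookup-folds (t ∷ ts) (suc i) = lookup-folds ts i

module _ {a p} {S : Signature ℓ} {X : Set a} (P : Term S X → Set p)
  (P-var : ∀ x → P (var x))
  (P-op : ∀ f ts → (∀ i → P (lookup ts i)) → P (op f ts)) where

  Term-ind  : ∀ t → P t
  Terms-ind : ∀ {n} (ts : Vec (Term S X) n) i → P (lookup ts i)

  Term-ind (var x)   = P-var x
  Term-ind (op f ts) = P-op f ts (Terms-ind ts)

  Terms-ind (t ∷ ts) zero    = Term-ind t
  Terms-ind (t ∷ ts) (suc i) = Terms-ind ts i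

infixl 9 _⟪_⟫
_⟪_⟫ : ∀ {a b} {S : Signature ℓ} {X : Set a} {Y : Set b} →
  Term S X → (X → Term S Y) → Term S Y
t ⟪ σ ⟫ = fold op σ t

injˡ : ∀ {a} (S S′ : Signature ℓ) {X : Set a} → Term S X → Term (S ⊎ˢ S′) X
injˡ S S′ = fold (λ f → op (inj₁ f)) var

injʳ : ∀ {a} (S S′ : Signature ℓ) {X : Set a} → Term S′ X → Term (S ⊎ˢ S′) X
injʳ S S′ = fold (λ f → op (inj₂ f)) var

V : Set
V = ℕ

infix 5 _=[_]_
record QuantEq (S : Signature ℓ) : Set ℓ where
  constructor _=[_]_
  field
    lhs : Term S V
    ε   : ℚ≥0
    rhs : Term S V

-- The list of premises stands for the finite set of its members: assumption
-- and cut make its order and multiplicity irrelevant in any theory.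
infix 4 _⊢_
record CondEq (S : Signature ℓ) : Set ℓ where
  constructor _⊢_
  field
    premises   : List (QuantEq S)
    conclusion : QuantEq S

mapEq : {S S′ : Signature ℓ} →
  (Term S V → Term S′ V) → QuantEq S → QuantEq S′
mapEq h (t =[ ε ] s) = h t =[ ε ] h s

mapCond : {S S′ : Signature ℓ} →
  (Term S V → Term S′ V) → CondEq S → CondEq S′
mapCond h (Γ ⊢ φ) = map (mapEq h) Γ ⊢ mapEq h φ

-- Rule U φ: φ is the conclusion of a rule whose hypotheses lie in U.
data Rule {S : Signature ℓ} (U : Pred (CondEq S) ℓ) : Pred (CondEq S) ℓ where
  reflexivity : ∀ x →
    Rule U ([] ⊢ var x =[ 0q ] var x)
  symmetry : ∀ x y ε →
    Rule U ((var x =[ ε ] var y) ∷ [] ⊢ var y =[ ε ] var x)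
  triangle : ∀ x y z ε ε′ →
    Rule U ((var x =[ ε ] var z) ∷ (var z =[ ε′ ] var y) ∷ []
      ⊢ var x =[ ε + ε′ ] var y)
  weakening : ∀ x y ε ε′ → 0q < ε′ →
    Rule U ((var x =[ ε ] var y) ∷ [] ⊢ var x =[ ε + ε′ ] var y)
  nonexpansiveness : ∀ f (xs ys : Vec V (arity S f)) ε →
    Rule U (tabulate (λ i → var (lookup xs i) =[ ε ] var (lookup ys i))
      ⊢ op f (Vec.map var xs) =[ ε ] op f (Vec.map var ys))
  continuity : ∀ Γ t s ε →
    (∀ ε′ → ε < ε′ → U (Γ ⊢ t =[ ε′ ] s)) →
    Rule U (Γ ⊢ t =[ ε ] s)
  substitution : ∀ (σ : V → Term S V) Γ φ →
    U (Γ ⊢ φ) → Rule U (mapCond _⟪ σ ⟫ (Γ ⊢ φ))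
  assumption : ∀ Γ φ → φ ∈ Γ → Rule U (Γ ⊢ φ)
  cut : ∀ Γ Θ ψ → (∀ φ → φ ∈ Θ → U (Γ ⊢ φ)) → U (Θ ⊢ ψ) → Rule U (Γ ⊢ ψ)

record Theory (S : Signature ℓ) : Set (Level.suc ℓ) where
  field
    member   : Pred (CondEq S) ℓ
    isTheory : Rule member ⊆ member

open Theory

Axiomatizes : {S : Signature ℓ} → Pred (CondEq S) ℓ → Theory S → Set (Level.suc ℓ)
Axiomatizes {S = S} A U =
  A ⊆ member U × (∀ (U′ : Theory S) → A ⊆ member U′ → member U ⊆ member U′)

data Derivable {S : Signature ℓ} (A : Pred (CondEq S) ℓ) : Pred (CondEq S) ℓ where
  axiom : A ⊆ Derivable A
  rule  : Rule (Derivable A) ⊆ Derivable A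

⟨_⟩ : {S : Signature ℓ} → Pred (CondEq S) ℓ → Theory S
member   ⟨ A ⟩ = Derivable A
isTheory ⟨ A ⟩ = rule

⟨⟩-axiomatized : {S : Signature ℓ} (A : Pred (CondEq S) ℓ) → Axiomatizes A ⟨ A ⟩
⟨⟩-axiomatized {S = S} A = axiom , least
  where
  least : ∀ (U : Theory S) → A ⊆ member U → Derivable A ⊆ member U
  step  : ∀ (U : Theory S) → A ⊆ member U → Rule (Derivable A) ⊆ Rule (member U)

  least U A⊆U (axiom a) = A⊆U a
  least U A⊆U (rule r)  = isTheory U (step U A⊆U r)

  step U A⊆U (reflexivity x)              = reflexivity x
  step U A⊆U (symmetry x y ε)             = symmetry x y ε
  step U A⊆U (triangle x y z ε ε′)        = triangle x y z ε ε′
  step U A⊆U (weakening x y ε ε′ 0<ε′)    = weakening x y ε ε′ 0<ε′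
  step U A⊆U (nonexpansiveness f xs ys ε) = nonexpansiveness f xs ys ε
  step U A⊆U (continuity Γ t s ε p)       =
    continuity Γ t s ε λ ε′ ε<ε′ → least U A⊆U (p ε′ ε<ε′)
  step U A⊆U (substitution σ Γ φ p)       = substitution σ Γ φ (least U A⊆U p)
  step U A⊆U (assumption Γ φ φ∈Γ)         = assumption Γ φ φ∈Γ
  step U A⊆U (cut Γ Θ ψ p q)              =
    cut Γ Θ ψ (λ φ φ∈Θ → least U A⊆U (p φ φ∈Θ)) (least U A⊆U q)

Basic : {S : Signature ℓ} → Theory S → Set (Level.suc ℓ)
Basic {ℓ} {S} U = Σ[ A ∈ Pred (CondEq S) ℓ ]
  (∀ {Γ φ} → A (Γ ⊢ φ) → ∀ {ψ} → ψ ∈ Γ →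
    ∃[ x ] ∃[ ε ] ∃[ y ] (ψ ≡ (var x =[ ε ] var y)))
  × Axiomatizes A U

-- Disjointness of the signatures is built into _⊎ˢ_. The x i j need not be
-- distinct; the other instances follow from the distinct one by substitution.
data TensorAxiom {S S′ : Signature ℓ} (U : Theory S) (U′ : Theory S′) :
  Pred (CondEq (S ⊎ˢ S′)) ℓ where
  left  : ∀ {φ} → member U φ → TensorAxiom U U′ (mapCond (injˡ S S′) φ)
  right : ∀ {φ} → member U′ φ → TensorAxiom U U′ (mapCond (injʳ S S′) φ)
  commutation : ∀ f g (x : Fin (arity S f) → Fin (arity S′ g) → V) →
    TensorAxiom U U′
      ([] ⊢ op (inj₁ f) (Vec.tabulate λ i → op (inj₂ g) (Vec.tabulate λ j → var (x i j)))
       =[ 0q ] op (inj₂ g) (Vec.tabulate λ j → op (inj₁ f) (Vec.tabulate λ i → var (x i j))))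

infixl 7 _⊗_
_⊗_ : {S S′ : Signature ℓ} → Theory S → Theory S′ → Theory (S ⊎ˢ S′)
U ⊗ U′ = ⟨ TensorAxiom U U′ ⟩

record Algebra (S : Signature ℓ) : Set (Level.suc ℓ) where
  field
    space : Met ℓ
    ⟦_⟧   : ∀ f → space ^ arity S f ⇒ space

  open Met space public

  eval : ∀ {a} {X : Set a} → (X → Carrier) → Term S X → Carrier
  eval ι = fold (λ f as → to ⟦ f ⟧ (lookup as)) ι

  Holds : (V → Carrier) → QuantEq S → Set ℓ
  Holds ι (t =[ ε ] s) = d (eval ι t) (eval ι s) ≼ ε

  Satisfies : CondEq S → Set ℓ
  Satisfies (Γ ⊢ φ) = ∀ ι → (∀ ψ → ψ ∈ Γ → Holds ι ψ) → Holds ι φ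

record Model {S : Signature ℓ} (U : Theory S) : Set (Level.suc ℓ) where
  field
    algebra   : Algebra S
    satisfies : ∀ φ → member U φ → Algebra.Satisfies algebra φ

  open Algebra algebra public

-- Morphisms of the full category of models of U.
record Hom {S : Signature ℓ} {U : Theory S} (A B : Model U) : Set ℓ where
  private
    module A = Model A
    module B = Model B
  field
    fun       : A.space ⇒ B.space
    preserves : ∀ f xs → to fun (to A.⟦ f ⟧ xs) B.≈ to B.⟦ f ⟧ (to fun ∘ xs)

open Hom

module _ {S : Signature ℓ} {U : Theory S} where

  idHom : (A : Model U) → Hom A A
  fun       (idHom A) = idM (Model.space A)
  preserves (idHom A) f xs = Model.≈-refl A

  infixr 9 _∙ʰ_
  _∙ʰ_ : {A B C : Model U} → Hom B C → Hom A B → Hom A C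
  fun       (h ∙ʰ k) = fun h ∙ fun k
  preserves (_∙ʰ_ {C = C} h k) f xs = Model.≈-trans C
    (to-cong (fun h) (preserves k f xs)) (preserves h f (to (fun k) ∘ xs))

-- A universal arrow from X to the forgetful functor into Met.
record FreeModel {S : Signature ℓ} (U : Theory S) (X : Met ℓ) : Set (Level.suc ℓ) where
  field
    model : Model U

  open Model model public using (space)

  field
    unit       : X ⇒ space
    ext        : (B : Model U) → X ⇒ Model.space B → Hom model B
    ext-unit   : ∀ B f → fun (ext B f) ∙ unit ≗ f
    ext-unique : ∀ B f (h : Hom model B) → fun h ∙ unit ≗ f → fun h ≗ fun (ext B f)

module _ {S : Signature ℓ} {U : Theory S} (F : ∀ X → FreeModel U X) where
  private
    module F X = FreeModel (F X)

    T₀ : Met ℓ → Met ℓ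
    T₀ = F.space

    η : ∀ X → X ⇒ T₀ X
    η = F.unit

    hom : ∀ {X Y} → X ⇒ Y → Hom (F.model X) (F.model Y)
    hom {X} {Y} f = F.ext X (F.model Y) (η Y ∙ f)

    hom-η : ∀ {X Y} (f : X ⇒ Y) → fun (hom f) ∙ η X ≗ η Y ∙ f
    hom-η {X} {Y} f = F.ext-unit X (F.model Y) (η Y ∙ f)

    ε : ∀ A → Hom (F.model (Model.space A)) A
    ε A = F.ext (Model.space A) A (idM (Model.space A))

    ε-η : ∀ A → fun (ε A) ∙ η (Model.space A) ≗ idM (Model.space A)
    ε-η A = F.ext-unit (Model.space A) A (idM (Model.space A))

    μ : ∀ X → T₀ (T₀ X) ⇒ T₀ X
    μ X = fun (ε (F.model X))

    agree : ∀ {X} (B : Model U) (h k : Hom (F.model X) B) →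
      fun h ∙ η X ≗ fun k ∙ η X → fun h ≗ fun k
    agree {X} B h k p u = Model.≈-trans B
      (F.ext-unique X B (fun k ∙ η X) h p u)
      (Model.≈-sym B (F.ext-unique X B (fun k ∙ η X) k (λ _ → Model.≈-refl B) u))

    ε-natural : ∀ {A B} (h : Hom A B) → fun h ∙ fun (ε A) ≗ fun (ε B) ∙ fun (hom (fun h))
    ε-natural {A} {B} h = agree B (h ∙ʰ ε A) (ε B ∙ʰ hom (fun h)) λ x →
      Model.≈-trans B (to-cong (fun h) (ε-η A x)) (Model.≈-sym B
        (Model.≈-trans B (to-cong (fun (ε B)) (hom-η (fun h) x)) (ε-η B _)))

  inducedMonad : Monad ℓ
  inducedMonad = record
    { T₀ = T₀
    ; T₁ = λ f → fun (hom f)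
    ; η  = η
    ; μ  = μ
    ; T₁-cong = λ {X} {Y} {f} {g} p → agree (F.model Y) (hom f) (hom g) λ x →
        Met.≈-trans (T₀ Y) (hom-η f x)
          (Met.≈-trans (T₀ Y) (to-cong (η Y) (p x)) (Met.≈-sym (T₀ Y) (hom-η g x)))
    ; T₁-id = λ X → agree (F.model X) (hom (idM X)) (idHom (F.model X)) (hom-η (idM X))
    ; T₁-∙ = λ {X} {Y} {Z} g f → agree (F.model Z) (hom (g ∙ f)) (hom g ∙ʰ hom f) λ x →
        Met.≈-trans (T₀ Z) (hom-η (g ∙ f) x) (Met.≈-sym (T₀ Z)
          (Met.≈-trans (T₀ Z) (to-cong (fun (hom g)) (hom-η f x)) (hom-η g (to f x))))
    ; η-natural = hom-η
    ; μ-natural = λ f → ε-natural (hom f)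
    ; identityˡ = λ X → ε-η (F.model X)
    ; identityʳ = λ X → agree (F.model X) (ε (F.model X) ∙ʰ hom (η X)) (idHom (F.model X))
        λ x → Met.≈-trans (T₀ X) (to-cong (μ X) (hom-η (η X) x)) (ε-η (F.model X) (to (η X) x))
    ; assoc = λ X u → Met.≈-sym (T₀ X) (ε-natural (ε (F.model X)) u)
    }

-- The term model: terms over X at distance ≤ ε when t =_ε s is derivable
-- from U and the distances in X.
module TermModel {S : Signature ℓ} (U : Theory S) (X : Met ℓ) where

  data Dist : Term S ∣ X ∣ → ℚ≥0 → Term S ∣ X ∣ → Set ℓ where
    generator  : ∀ {x y ε} → Met.d X x y ≼ ε → Dist (var x) ε (var y)
    congruence : ∀ f ts ss {ε} → (∀ i → Dist (lookup ts i) ε (lookup ss i)) →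
      Dist (op f ts) ε (op f ss)
    entailed   : ∀ {Γ t ε s} → member U (Γ ⊢ t =[ ε ] s) →
      (σ : V → Term S ∣ X ∣) →
      (∀ t′ δ s′ → (t′ =[ δ ] s′) ∈ Γ → Dist (t′ ⟪ σ ⟫) δ (s′ ⟪ σ ⟫)) →
      Dist (t ⟪ σ ⟫) ε (s ⟪ σ ⟫)
    limit      : ∀ {t ε s} → (∀ δ → ε < δ → Dist t δ s) → Dist t ε s

  private
    assign : Term S ∣ X ∣ → Term S ∣ X ∣ → Term S ∣ X ∣ → V → Term S ∣ X ∣
    assign t s r 0 = t
    assign t s r 1 = s
    assign t s r _ = r

  Dist-refl : ∀ t → Dist t 0q t
  Dist-refl t = entailed (isTheory U (reflexivity 0)) (assign t t t) λ _ _ _ ()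

  Dist-sym : ∀ {t ε s} → Dist t ε s → Dist s ε t
  Dist-sym {t} {ε} {s} p =
    entailed (isTheory U (symmetry 0 1 ε)) (assign t s s) λ { _ _ _ (here refl) → p }

  Dist-triangle : ∀ {t ε r δ s} → Dist t ε r → Dist r δ s → Dist t (ε + δ) s
  Dist-triangle {t} {ε} {r} {δ} {s} p q =
    entailed (isTheory U (triangle 0 1 2 ε δ)) (assign t s r) λ where
      _ _ _ (here refl)         → p
      _ _ _ (there (here refl)) → q

  Dist-up : ∀ {t ε δ s} → ε ≤ δ → Dist t ε s → Dist t δ s
  Dist-up {t} {ε} {δ} {s} ε≤δ p with ≤-split ε δ ε≤δ
  ... | inj₁ refl = p
  ... | inj₂ (η , 0<η , refl) =
    entailed (isTheory U (weakening 0 1 ε η 0<η)) (assign t s s) λ { _ _ _ (here refl) → p }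

  space : Met ℓ
  space = record
    { setoid = record
      { Carrier = Term S ∣ X ∣
      ; _≈_ = λ t s → Dist t 0q s
      ; isEquivalence = record
        { refl  = Dist-refl _
        ; sym   = Dist-sym
        ; trans = λ {t} {r} {s} p q →
            subst (λ ε → Dist t ε s) (+-identityˡ 0q) (Dist-triangle p q)
        }
      }
    ; d = dist
    ; d≈0⇒≈ = λ p → proj₁ p 0q (lift ℚ.≤-refl)
    ; ≈⇒d≈0 = λ {t} {s} → ≼0⇒≈0 (dist t s)
    ; d-sym = λ t s → (λ ε → Dist-sym) , (λ ε → Dist-sym)
    ; d-triangle = λ t s r ε p → limit λ δ ε<δ →
        let α , β , pα , pβ , α+β≤δ = p δ ε<δ
        in Dist-up {ε = α + β} {δ} α+β≤δ (Dist-triangle pα pβ)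
    }
    where
    dist : Term S ∣ X ∣ → Term S ∣ X ∣ → [0,∞] ℓ
    bound  (dist t s) ε = Dist t ε s
    upward (dist t s) {ε} {δ} = Dist-up {ε = ε} {δ}
    closed (dist t s) = limit

  algebra : Algebra S
  algebra = record
    { space = space
    ; ⟦_⟧ = λ f → record
      { to = λ ts → op f (Vec.tabulate ts)
      ; nonexpansive = λ ts ss ε p → congruence f (Vec.tabulate ts) (Vec.tabulate ss) λ i →
          subst₂ (λ t s → Dist t ε s)
            (sym (lookup∘tabulate ts i)) (sym (lookup∘tabulate ss i)) (p i)
      }
    }

  private
    module A = Algebra algebra

  eval-⟪⟫ : ∀ {a} {Y : Set a} (σ : Y → Term S ∣ X ∣) t → A.eval σ t ≡ t ⟪ σ ⟫
  eval-⟪⟫ σ = Term-ind _ (λ _ → refl) λ f ts ih →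
    cong (op f) (trans (tabulate-cong λ i →
      trans (lookup-folds _ σ ts i) (trans (ih i) (sym (lookup-folds op σ ts i))))
      (tabulate∘lookup (folds op σ ts)))

  satisfies : ∀ φ → member U φ → A.Satisfies φ
  satisfies (Γ ⊢ (t =[ ε ] s)) u σ p =
    subst₂ (λ t s → Dist t ε s) (sym (eval-⟪⟫ σ t)) (sym (eval-⟪⟫ σ s))
      (entailed u σ λ t′ δ s′ m →
        subst₂ (λ t s → Dist t δ s) (eval-⟪⟫ σ t′) (eval-⟪⟫ σ s′) (p (t′ =[ δ ] s′) m))

  model : Model U
  model = record { algebra = algebra ; satisfies = satisfies }

  module _ (B : Model U) (f : X ⇒ Model.space B) where
    private
      module B = Model B

    eval-subst : (σ : V → Term S ∣ X ∣) → ∀ t →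
      B.eval (to f) (t ⟪ σ ⟫) B.≈ B.eval (B.eval (to f) ∘ σ) t
    eval-subst σ = Term-ind _ (λ _ → B.≈-refl) λ g ts ih →
      to-cong B.⟦ g ⟧ λ i →
        subst₂ B._≈_
          (sym (trans (lookup-folds _ (to f) (folds op σ ts) i)
            (cong (B.eval (to f)) (lookup-folds op σ ts i))))
          (sym (lookup-folds _ (B.eval (to f) ∘ σ) ts i))
          (ih i)

    eval-nonexp : ∀ {t ε s} → Dist t ε s → B.d (B.eval (to f) t) (B.eval (to f) s) ≼ ε
    eval-nonexp (generator {x} {y} {ε} p) = nonexpansive f x y ε p
    eval-nonexp (congruence g ts ss {ε} p) =
      nonexpansive B.⟦ g ⟧ _ _ ε λ i →
        subst₂ (λ a b → B.d a b ≼ ε)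
          (sym (lookup-folds _ (to f) ts i)) (sym (lookup-folds _ (to f) ss i))
          (eval-nonexp (p i))
    eval-nonexp (entailed {Γ} {t} {ε} {s} u σ p) =
      B.d-resp ε (B.≈-sym (eval-subst σ t)) (B.≈-sym (eval-subst σ s))
        (B.satisfies _ u (B.eval (to f) ∘ σ) λ where
          (t′ =[ δ ] s′) m →
            B.d-resp δ (eval-subst σ t′) (eval-subst σ s′) (eval-nonexp (p t′ δ s′ m)))
    eval-nonexp {t} {ε} {s} (limit p) =
      closed (B.d (B.eval (to f) t) (B.eval (to f) s)) λ δ ε<δ → eval-nonexp (p δ ε<δ)

    ext : Hom model B
    to           (fun ext) = B.eval (to f)
    nonexpansive (fun ext) t s ε = eval-nonexp
    preserves ext g ts = to-cong B.⟦ g ⟧ λ i → subst (B._≈ B.eval (to f) (ts i))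
      (sym (trans (lookup-folds _ (to f) (Vec.tabulate ts) i)
        (cong (B.eval (to f)) (lookup∘tabulate ts i))))
      B.≈-refl

    ext-unique : (h : Hom model B) → (∀ x → to (fun h) (var x) B.≈ to f x) →
      fun h ≗ fun ext
    ext-unique h p = Term-ind _ p λ g ts ih →
      subst (λ ts′ → to (fun h) (op g ts′) B.≈ B.eval (to f) (op g ts))
        (tabulate∘lookup ts)
        (B.≈-trans (preserves h g (lookup ts)) (to-cong B.⟦ g ⟧ λ i →
          subst (to (fun h) (lookup ts i) B.≈_) (sym (lookup-folds _ (to f) ts i)) (ih i)))

  freeModel : FreeModel U X
  freeModel = record
    { model      = model
    ; unit       = record { to = var ; nonexpansive = λ _ _ _ → generator }
    ; ext        = ext
    ; ext-unit   = λ B f x → Model.≈-refl B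
    ; ext-unique = ext-unique
    }

freeMonad : {S : Signature ℓ} → Theory S → Monad ℓ
freeMonad U = inducedMonad (TermModel.freeModel U)

record MetricMonoid (ℓ : Level) : Set (Level.suc ℓ) where
  infixl 7 _*_
  field
    space : Met ℓ

  open Met space public

  field
    _*_      : Carrier → Carrier → Carrier
    0#       : Carrier
    isMonoid : IsMonoid _≈_ _*_ 0#
    *-nonexp : ∀ α β α′ β′ → d (α * β) (α′ * β′) ≤∞ d α α′ +∞ d β β′

module _ (Λ : MetricMonoid ℓ) where
  private
    module Λ = MetricMonoid Λ
    module M = IsMonoid Λ.isMonoid

  -- Symbols w α and w β with α ≈ β are identified by diff.
  WriterSignature : Signature ℓ
  Op    WriterSignature   = Λ.Carrier
  arity WriterSignature _ = 1

  private
    w : Λ.Carrier → Term WriterSignature V → Term WriterSignature V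
    w α t = op α (t ∷ [])

  data WriterAxiom : Pred (CondEq WriterSignature) ℓ where
    unit : ∀ x → WriterAxiom ([] ⊢ var x =[ 0q ] w Λ.0# (var x))
    mult : ∀ α α′ x →
      WriterAxiom ([] ⊢ w α (w α′ (var x)) =[ 0q ] w (α Λ.* α′) (var x))
    diff : ∀ α α′ x x′ ε δ → Λ.d α α′ +∞ fromℚ≥0 ε ≤∞ fromℚ≥0 δ →
      WriterAxiom ((var x =[ ε ] var x′) ∷ [] ⊢ w α (var x) =[ δ ] w α′ (var x′))

  Writer : Theory WriterSignature
  Writer = ⟨ WriterAxiom ⟩

  □-map : ∀ (W : Met ℓ) {X Y : Met ℓ} → X ⇒ Y → W □ X ⇒ W □ Y
  to (□-map W f) (α , x) = α , to f x
  nonexpansive (□-map W {X} {Y} f) (α , x) (β , y) =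
    +∞-mono (Met.d W α β) (Met.d W α β)
      (Met.d Y (to f x) (to f y)) (Met.d X x y) (λ _ p → p) (nonexpansive f x y)

  writerMonad : Monad ℓ
  writerMonad = record
    { T₀ = Λ.space □_
    ; T₁ = □-map Λ.space
    ; η = λ X → record
      { to = λ x → Λ.0# , x
      ; nonexpansive = λ x y →
          +∞-identityˡ-≤ (Λ.d Λ.0# Λ.0#) (Met.d X x y) (Λ.≈⇒d≼ 0q Λ.≈-refl)
      }
    ; μ = λ X → record
      { to = λ (α , (α′ , x)) → α Λ.* α′ , x
      ; nonexpansive = λ (α , (α′ , x)) (β , (β′ , y)) →
          let r = Λ.d α β ; s = Λ.d α′ β′ ; t = Met.d X x y ; m = Λ.d (α Λ.* α′) (β Λ.* β′) in
          ≤∞-trans (m +∞ t) ((r +∞ s) +∞ t) (r +∞ (s +∞ t))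
            (+∞-mono m (r +∞ s) t t (Λ.*-nonexp α α′ β β′) (λ _ p → p))
            (+∞-assoc-≤ r s t)
      }
    ; T₁-cong = λ p (α , x) → Λ.≈-refl , p x
    ; T₁-id = λ X _ → Λ.≈-refl , Met.≈-refl X
    ; T₁-∙ = λ {_} {_} {Z} g f _ → Λ.≈-refl , Met.≈-refl Z
    ; η-natural = λ {_} {Y} f _ → Λ.≈-refl , Met.≈-refl Y
    ; μ-natural = λ {_} {Y} f _ → Λ.≈-refl , Met.≈-refl Y
    ; identityˡ = λ X (α , x) → M.identityˡ α , Met.≈-refl X
    ; identityʳ = λ X (α , x) → M.identityʳ α , Met.≈-refl X
    ; assoc = λ X (α , (α′ , (α″ , x))) → M.sym (M.assoc α α′ α″) , Met.≈-refl X
    }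

pair : (X Y : Met ℓ) → ∣ X ∣ → Y ⇒ X □ Y
to           (pair X Y x) y = x , y
nonexpansive (pair X Y x) y y′ =
  +∞-identityˡ-≤ (Met.d X x x) (Met.d Y y y′) (Met.≈⇒d≼ X 0q (Met.≈-refl X))

module _ (T : Monad ℓ) where
  open Monad T

  strength : (X Y : Met ℓ) → ∣ X □ T₀ Y ∣ → ∣ T₀ (X □ Y) ∣
  strength X Y (x , u) = to (T₁ (pair X Y x)) u

  Strong : Set (Level.suc ℓ)
  Strong = ∀ X Y p q →
    Met.d (T₀ (X □ Y)) (strength X Y p) (strength X Y q) ≤∞ Met.d (X □ T₀ Y) p q

  private
    factor : ∀ {X Y Z} (g : Y ⇒ Z) (f : X ⇒ Y) (h : X ⇒ Z) →
      h ≗ g ∙ f → T₁ h ≗ T₁ g ∙ T₁ f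
    factor {Z = Z} g f h q u =
      Met.≈-trans (T₀ Z) (T₁-cong {f = h} {g ∙ f} q u) (T₁-∙ g f u)

  writerLaw : (Λ : MetricMonoid ℓ) → Strong → DistributiveLaw (writerMonad Λ) T
  writerLaw Λ strong = record
    { law = t
    ; natural = natural
    ; law-Sη = λ X → T₁-cong {f = p X Λ.0#} {S.η X} λ x → Met.≈-refl (Λ.space □ X)
    ; law-Tη = λ X (α , x) → η-natural (p X α) x
    ; law-Sμ = law-Sμ
    ; law-Tμ = law-Tμ
    }
    where
    module Λ = MetricMonoid Λ
    module S = Monad (writerMonad Λ)

    p : ∀ X → Λ.Carrier → X ⇒ Λ.space □ X
    p = pair Λ.space

    t : ∀ X → Λ.space □ T₀ X ⇒ T₀ (Λ.space □ X)
    to           (t X) = strength Λ.space X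
    nonexpansive (t X) = strong Λ.space X

    natural : ∀ {X Y} (f : X ⇒ Y) → T₁ (S.T₁ f) ∙ t X ≗ t Y ∙ S.T₁ (T₁ f)
    natural {X} {Y} f (α , u) = Met.≈-trans (T₀ (Λ.space □ Y))
      (Met.≈-sym (T₀ (Λ.space □ Y))
        (factor (S.T₁ f) (p X α) h (λ _ → Met.≈-refl (Λ.space □ Y)) u))
      (factor (p Y α) f h (λ _ → Met.≈-refl (Λ.space □ Y)) u)
      where
      h : X ⇒ Λ.space □ Y
      h = p Y α ∙ f

    law-Sμ : ∀ X → t X ∙ S.μ (T₀ X) ≗ T₁ (S.μ X) ∙ (t (S.T₀ X) ∙ S.T₁ (t X))
    law-Sμ X (α , (α′ , u)) = Met.≈-trans (T₀ (Λ.space □ X))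
      (factor (S.μ X) (p (Λ.space □ X) α ∙ p X α′) (p X (α Λ.* α′))
        (λ _ → Met.≈-refl (Λ.space □ X)) u)
      (to-cong (T₁ (S.μ X)) (T₁-∙ (p (Λ.space □ X) α) (p X α′) u))

    law-Tμ : ∀ X → t X ∙ S.T₁ (μ X) ≗ μ (S.T₀ X) ∙ (T₁ (t X) ∙ t (T₀ X))
    law-Tμ X (α , u) = Met.≈-trans (T₀ (Λ.space □ X))
      (μ-natural (p X α) u)
      (to-cong (μ (Λ.space □ X))
        (factor (t X) (p (T₀ X) α) (T₁ (p X α))
          (λ _ → Met.≈-refl (T₀ (Λ.space □ X))) u))

freeMonad-strong : {S : Signature ℓ} (U : Theory S) → Strong (freeMonad U)
freeMonad-strong {S = S} U X Y (x , u) (x′ , u′) ε p = limit λ δ ε<δ →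
  let α , β , xα , uβ , α+β≤δ = p δ ε<δ
  in Dist-up {ε = α + β} {δ} α+β≤δ (Dist-triangle (vary α xα u)
       (nonexpansive (T₁ (pair X Y x′)) u u′ β uβ))
  where
  open Monad (freeMonad U)
  open TermModel U (X □ Y)

  vary : ∀ α → Met.d X x x′ ≼ α → ∀ u →
    Dist (to (T₁ (pair X Y x)) u) α (to (T₁ (pair X Y x′)) u)
  vary α xα = Term-ind _
    (λ y → generator (λ δ α<δ → α , 0q , xα , Met.≈⇒d≼ Y 0q (Met.≈-refl Y) ,
      ℚ.<⇒≤ (subst (ℚ._< value δ) (sym (ℚ.+-identityʳ (value α))) α<δ)))
    λ f ts ih → nonexpansive (Algebra.⟦_⟧ algebra f) _ _ α λ i →
      subst₂ (λ t s → Dist t α s)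
        (sym (lookup-folds _ _ ts i)) (sym (lookup-folds _ _ ts i)) (ih i)

writerComposite : {S : Signature ℓ} → Theory S → MetricMonoid ℓ → Monad ℓ
writerComposite U Λ = composite (writerMonad Λ) (freeMonad U)
  (writerLaw (freeMonad U) Λ (freeMonad-strong U))

{-# OPTIONS --safe #-}
module Submission where

-- On T(Λ □ X) let w α act as Tς ∘ t(α , −). This is a homomorphism for the
-- operations of U, which is the commutation axiom, and strength of T gives the
-- distance axiom of the writer theory, so T(Λ □ X) is a model of U ⊗ W. It is
-- free on X: for f : X ⇒ B with B a model, (α , x) ↦ w α (f x) is non-expansive
-- on Λ □ X and extends to a U-homomorphism T(Λ □ X) ⇒ B. This also preserves w α,
-- as w α is a U-homomorphism on both sides and the two composites agree on
-- Λ □ X; uniqueness holds because η(α , x) = w α (η(0 , x)). Composite functor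
-- and multiplication are homomorphisms for this structure, so the comparison
-- with any other free model is an isomorphism of monads.

open import Defs
open import Algebra.Structures using (IsMonoid)
open import Data.Fin.Base using (Fin; zero; suc; toℕ; combine; remQuot)
open import Data.Fin.Properties using (remQuot-combine)
open import Data.List.Membership.Propositional using (_∈_)
open import Data.List.Membership.Propositional.Properties
  using (∈-map⁺; ∈-map⁻; ∈-tabulate⁺)
open import Data.List.Relation.Unary.Any using (here; there)
open import Data.Nat.Base using (ℕ; zero; suc)
open import Data.Product.Base using (_,_; proj₁; proj₂)
import Data.Rational.Properties as ℚ
open import Data.Sum.Base using (inj₁; inj₂)
open import Data.Vec.Base as Vec using (Vec; []; _∷_; lookup)
open import Data.Vec.Properties using (lookup-map; lookup∘tabulate)
open import Function.Base using (_∘_)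
open import Level as Level using (Level; lift; lower)
open import Relation.Binary.Bundles using (Setoid)
import Relation.Binary.Reasoning.Setoid as SetoidReasoning
open import Relation.Binary.PropositionalEquality
  using (_≡_; refl; sym; trans; cong; cong₂; subst₂)
open import Relation.Unary using (_⊆_)

open Signature
open Theory
open Hom
open [0,∞]

private
  variable
    ℓ : Level

-- Assignments of variables and fusion of folds over terms.

extend : ∀ {a} {A : Set a} {n} → (Fin n → A) → A → ℕ → A
extend {n = zero}  a d k       = d
extend {n = suc n} a d zero    = a zero
extend {n = suc n} a d (suc k) = extend (a ∘ suc) d k

extend-toℕ : ∀ {a} {A : Set a} {n} (a : Fin n → A) d i → extend a d (toℕ i) ≡ a i
extend-toℕ a d zero    = refl
extend-toℕ a d (suc i) = extend-toℕ (a ∘ suc) d i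

folds≡map : ∀ {a b} {S : Signature ℓ} {X : Set a} {B : Set b}
  (alg : (f : Op S) → Vec B (arity S f) → B) (ι : X → B)
  {n} (ts : Vec (Term S X) n) → folds alg ι ts ≡ Vec.map (fold alg ι) ts
folds≡map alg ι []       = refl
folds≡map alg ι (t ∷ ts) = cong (fold alg ι t ∷_) (folds≡map alg ι ts)

module _ {a b c} {S : Signature ℓ} {X : Set a} {B : Set b} {C : Set c}
  {alg : (f : Op S) → Vec B (arity S f) → B}
  {alg′ : (f : Op S) → Vec C (arity S f) → C}
  {ι : X → B} (h : B → C)
  (h-alg : ∀ f bs → h (alg f bs) ≡ alg′ f (Vec.map h bs)) where

  -- With `h` an evaluation and `alg` building syntax, fusion gives that evaluation commutes with
  -- substitution and with both injections of signatures.
  fold-fusion  : ∀ t → h (fold alg ι t) ≡ fold alg′ (h ∘ ι) t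
  folds-fusion : ∀ {n} (ts : Vec (Term S X) n) →
    Vec.map h (folds alg ι ts) ≡ folds alg′ (h ∘ ι) ts

  fold-fusion (var x)   = refl
  fold-fusion (op f ts) = trans (h-alg f _) (cong (alg′ f) (folds-fusion ts))

  folds-fusion []       = refl
  folds-fusion (t ∷ ts) = cong₂ _∷_ (fold-fusion t) (folds-fusion ts)

-- Satisfaction of conditional equations and soundness.

algebraOn : {S : Signature ℓ} (Z : Met ℓ) → (∀ f → Z ^ arity S f ⇒ Z) → Algebra S
algebraOn Z ⟦_⟧ = record { space = Z ; ⟦_⟧ = ⟦_⟧ }

module _ {S S′ : Signature ℓ} {Z : Met ℓ}
  (⟦_⟧ : ∀ f → Z ^ arity S f ⇒ Z) (⟦_⟧′ : ∀ g → Z ^ arity S′ g ⇒ Z) where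
  private
    module A = Algebra (algebraOn {S = S} Z ⟦_⟧)
    module B = Algebra (algebraOn {S = S′} Z ⟦_⟧′)

  -- The map `τ` lets a translation change the assignment: substitution by `σ` replaces `ι` by
  -- `A.eval ι ∘ σ`, while the injections of signatures keep `ι`.
  Satisfies-mapCond⁺ : (h : Term S V → Term S′ V) (τ : (V → ∣ Z ∣) → V → ∣ Z ∣) →
    (∀ ι t → B.eval ι (h t) ≡ A.eval (τ ι) t) →
    ∀ φ → A.Satisfies φ → B.Satisfies (mapCond h φ)
  Satisfies-mapCond⁺ h τ eval-h (Γ ⊢ (t =[ ε ] s)) sat ι p =
    subst₂ (λ a b → A.d a b ≼ ε) (sym (eval-h ι t)) (sym (eval-h ι s))
      (sat (τ ι) λ { (t′ =[ δ ] s′) m →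
        subst₂ (λ a b → A.d a b ≼ δ) (eval-h ι t′) (eval-h ι s′)
          (p _ (∈-map⁺ (mapEq h) m)) })

  Satisfies-mapCond⁻ : (h : Term S V → Term S′ V) →
    (∀ ι t → B.eval ι (h t) ≡ A.eval ι t) →
    ∀ φ → B.Satisfies (mapCond h φ) → A.Satisfies φ
  Satisfies-mapCond⁻ h eval-h (Γ ⊢ (t =[ ε ] s)) sat ι p =
    subst₂ (λ a b → A.d a b ≼ ε) (eval-h ι t) (eval-h ι s) (sat ι holds)
    where
    holds : ∀ ψ → ψ ∈ CondEq.premises (mapCond h (Γ ⊢ (t =[ ε ] s))) → B.Holds ι ψ
    holds ψ m with ∈-map⁻ (mapEq h) m
    ... | (t′ =[ δ ] s′) , m′ , refl =
      subst₂ (λ a b → A.d a b ≼ δ) (sym (eval-h ι t′)) (sym (eval-h ι s′)) (p _ m′)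

module _ {S : Signature ℓ} (A : Algebra S) where
  private
    module A = Algebra A

  eval-⟪⟫ : ∀ {x y} {X : Set x} {Y : Set y} (ι : Y → A.Carrier) (σ : X → Term S Y) t →
    A.eval ι (t ⟪ σ ⟫) ≡ A.eval (A.eval ι ∘ σ) t
  eval-⟪⟫ ι σ = fold-fusion (A.eval ι) λ f ts →
    cong (to A.⟦ f ⟧ ∘ lookup) (folds≡map _ ι ts)

  eval-tabulate : ∀ {x} {X : Set x} (ι : X → A.Carrier) f (t : Fin (arity S f) → Term S X) →
    A.eval ι (op f (Vec.tabulate t)) A.≈ to A.⟦ f ⟧ (A.eval ι ∘ t)
  eval-tabulate ι f t = to-cong A.⟦ f ⟧ λ i → Setoid.reflexive A.setoid
    (trans (lookup-folds _ ι (Vec.tabulate t) i) (cong (A.eval ι) (lookup∘tabulate t i)))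

  eval-nested : ∀ {x} {X : Set x} (ι : X → A.Carrier) f g
    (a : Fin (arity S f) → Fin (arity S g) → X) →
    A.eval ι (op f (Vec.tabulate λ i → op g (Vec.tabulate λ j → var (a i j))))
    A.≈ to A.⟦ f ⟧ (λ i → to A.⟦ g ⟧ (ι ∘ a i))
  eval-nested ι f g a = A.≈-trans
    (eval-tabulate ι f λ i → op g (Vec.tabulate λ j → var (a i j)))
    (to-cong A.⟦ f ⟧ λ i → eval-tabulate ι g (var ∘ a i))

  -- Closure under each rule is soundness of that rule. Once the satisfied conditional equations
  -- form a theory, soundness of derivations follows from the minimality of `⟨ Ax ⟩`.
  theoryOf : Theory S
  member   theoryOf = A.Satisfies
  isTheory theoryOf (reflexivity x) ι p = A.≈⇒d≼ 0q A.≈-refl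
  isTheory theoryOf (symmetry x y ε) ι p = A.d-sym≼ (ι x) (ι y) (p _ (here refl))
  isTheory theoryOf (triangle x y z ε ε′) ι p =
    A.triangle≼ (ι x) (ι z) (ι y) (p _ (here refl)) (p _ (there (here refl)))
  isTheory theoryOf (weakening x y ε ε′ _) ι p =
    upward (A.d (ι x) (ι y)) {ε} {ε + ε′} (ε≤ε+δ ε ε′) (p _ (here refl))
  isTheory theoryOf (nonexpansiveness f xs ys ε) ι p =
    nonexpansive A.⟦ f ⟧ _ _ ε λ i →
      subst₂ (λ a b → A.d a b ≼ ε) (sym (lookup-vars xs i)) (sym (lookup-vars ys i))
        (p _ (∈-tabulate⁺ i))
    where
    lookup-vars : ∀ {n} (zs : Vec V n) i →
      lookup (folds (λ g as → to A.⟦ g ⟧ (lookup as)) ι (Vec.map var zs)) i ≡ ι (lookup zs i)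
    lookup-vars zs i = trans (lookup-folds _ ι (Vec.map var zs) i)
      (cong (A.eval ι) (lookup-map i var zs))
  isTheory theoryOf (continuity Γ t s ε q) ι p =
    closed (A.d (A.eval ι t) (A.eval ι s)) λ δ ε<δ → q δ ε<δ ι p
  isTheory theoryOf (substitution σ Γ φ q) =
    Satisfies-mapCond⁺ A.⟦_⟧ A.⟦_⟧ (_⟪ σ ⟫) (λ ι → A.eval ι ∘ σ) (λ ι → eval-⟪⟫ ι σ)
      (Γ ⊢ φ) q
  isTheory theoryOf (assumption Γ φ φ∈Γ) ι p = p φ φ∈Γ
  isTheory theoryOf (cut Γ Θ ψ q r) ι p = r ι λ φ φ∈Θ → q φ φ∈Θ ι p

  sound : ∀ {Ax} → Ax ⊆ A.Satisfies → ∀ φ → member ⟨ Ax ⟩ φ → A.Satisfies φ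
  sound {Ax} Ax⊆A φ = proj₂ (⟨⟩-axiomatized Ax) theoryOf Ax⊆A

-- Models of a tensor: two reducts whose operations commute.

module _ {S S′ : Signature ℓ} (A : Algebra (S ⊎ˢ S′)) where
  private
    module A = Algebra A

  reductˡ : Algebra S
  reductˡ = algebraOn A.space (A.⟦_⟧ ∘ inj₁)

  reductʳ : Algebra S′
  reductʳ = algebraOn A.space (A.⟦_⟧ ∘ inj₂)

  eval-injˡ : ∀ {x} {X : Set x} (ι : X → A.Carrier) t →
    A.eval ι (injˡ S S′ t) ≡ Algebra.eval reductˡ ι t
  eval-injˡ ι = fold-fusion (A.eval ι) λ f ts →
    cong (to A.⟦ inj₁ f ⟧ ∘ lookup) (folds≡map _ ι ts)

  eval-injʳ : ∀ {x} {X : Set x} (ι : X → A.Carrier) t →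
    A.eval ι (injʳ S S′ t) ≡ Algebra.eval reductʳ ι t
  eval-injʳ ι = fold-fusion (A.eval ι) λ g ts →
    cong (to A.⟦ inj₂ g ⟧ ∘ lookup) (folds≡map _ ι ts)

  Commutes : Set _
  Commutes = ∀ f g (a : Fin (arity S f) → Fin (arity S′ g) → A.Carrier) →
    to A.⟦ inj₁ f ⟧ (λ i → to A.⟦ inj₂ g ⟧ (a i)) A.≈
    to A.⟦ inj₂ g ⟧ (λ j → to A.⟦ inj₁ f ⟧ (λ i → a i j))

  module _ (U : Theory S) (U′ : Theory S′) where

    satisfies-⊗ : (∀ φ → member U φ → Algebra.Satisfies reductˡ φ) →
      (∀ φ → member U′ φ → Algebra.Satisfies reductʳ φ) → Commutes →
      ∀ φ → member (U ⊗ U′) φ → A.Satisfies φ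
    satisfies-⊗ satˡ satʳ comm = sound A λ where
      (left {φ} u)  → Satisfies-mapCond⁺ (A.⟦_⟧ ∘ inj₁) A.⟦_⟧ (injˡ S S′)
        (λ ι → ι) eval-injˡ φ (satˡ φ u)
      (right {φ} u) → Satisfies-mapCond⁺ (A.⟦_⟧ ∘ inj₂) A.⟦_⟧ (injʳ S S′)
        (λ ι → ι) eval-injʳ φ (satʳ φ u)
      (commutation f g x) ι p → A.≈⇒d≼ 0q
        (A.≈-trans (eval-nested A ι (inj₁ f) (inj₂ g) x)
        (A.≈-trans (comm f g (λ i → ι ∘ x i))
        (A.≈-sym (eval-nested A ι (inj₂ g) (inj₁ f) (λ j i → x i j)))))

module _ {S S′ : Signature ℓ} {U : Theory S} {U′ : Theory S′} (B : Model (U ⊗ U′)) where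
  private
    module B = Model B

  modelˡ : Model U
  modelˡ = record
    { algebra   = reductˡ B.algebra
    ; satisfies = λ φ u → Satisfies-mapCond⁻ (B.⟦_⟧ ∘ inj₁) B.⟦_⟧ (injˡ S S′)
        (eval-injˡ B.algebra) φ (B.satisfies _ (axiom (left u)))
    }

  modelʳ : Model U′
  modelʳ = record
    { algebra   = reductʳ B.algebra
    ; satisfies = λ φ u → Satisfies-mapCond⁻ (B.⟦_⟧ ∘ inj₂) B.⟦_⟧ (injʳ S S′)
        (eval-injʳ B.algebra) φ (B.satisfies _ (axiom (right u)))
    }

  -- The axiom speaks of variables only. Numbering the index pairs by `combine` makes the variables
  -- `x i j` distinct, so that every matrix `a` of elements comes from an assignment.
  commutes : Commutes B.algebra
  commutes f g a = B.≈-trans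
    (to-cong B.⟦ inj₁ f ⟧ λ i → to-cong B.⟦ inj₂ g ⟧ λ j → B.≈-sym (ι-x i j))
    (B.≈-trans (B.≈-sym (eval-nested B.algebra ι (inj₁ f) (inj₂ g) x))
    (B.≈-trans (B.d≼0⇒≈ (B.satisfies _ (axiom (commutation f g x)) ι λ _ ()))
    (B.≈-trans (eval-nested B.algebra ι (inj₂ g) (inj₁ f) (λ j i → x i j))
    (to-cong B.⟦ inj₂ g ⟧ λ j → to-cong B.⟦ inj₁ f ⟧ λ i → ι-x i j))))
    where
    x : Fin (arity S f) → Fin (arity S′ g) → V
    x i j = toℕ (combine i j)

    ι : V → B.Carrier
    -- The variables beyond the matrix need some value. As `a` has no entries when an arity is 0,
    -- the default is the left side of the claim, an element that always exists.
    ι = extend (λ k → let i , j = remQuot (arity S′ g) k in a i j)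
          (to B.⟦ inj₁ f ⟧ λ i → to B.⟦ inj₂ g ⟧ (a i))

    ι-x : ∀ i j → ι (x i j) B.≈ a i j
    ι-x i j = Setoid.reflexive B.setoid (trans (extend-toℕ _ _ (combine i j))
      (cong (λ (i , j) → a i j) (remQuot-combine i j)))

-- A criterion for a monad to be the free monad on a theory.

record LiftsFreely {S : Signature ℓ} (U : Theory S) (M : Monad ℓ) : Set (Level.suc ℓ) where
  open Monad M
  field
    operation : ∀ X f → T₀ X ^ arity S f ⇒ T₀ X
    satisfies : ∀ X φ → member U φ →
      Algebra.Satisfies (algebraOn (T₀ X) (operation X)) φ

  model : ∀ X → Model U
  model X = record
    { algebra = algebraOn (T₀ X) (operation X) ; satisfies = satisfies X }

  field
    T₁-preserves : ∀ {X Y} (f : X ⇒ Y) g xs →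
      Met._≈_ (T₀ Y) (to (T₁ f) (to (operation X g) xs)) (to (operation Y g) (to (T₁ f) ∘ xs))
    μ-preserves  : ∀ X g xs →
      Met._≈_ (T₀ X) (to (μ X) (to (operation (T₀ X) g) xs)) (to (operation X g) (to (μ X) ∘ xs))
    ext          : ∀ {X} (B : Model U) → X ⇒ Model.space B → Hom (model X) B
    ext-η        : ∀ {X} (B : Model U) (f : X ⇒ Model.space B) → fun (ext B f) ∙ η X ≗ f
    η-epic       : ∀ {X} (B : Model U) (h k : Hom (model X) B) →
      fun h ∙ η X ≗ fun k ∙ η X → fun h ≗ fun k

  T₁-hom : ∀ {X Y} → X ⇒ Y → Hom (model X) (model Y)
  T₁-hom f = record { fun = T₁ f ; preserves = T₁-preserves f }

  μ-hom : ∀ X → Hom (model (T₀ X)) (model X)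
  μ-hom X = record { fun = μ X ; preserves = μ-preserves X }

hom-ext : {S : Signature ℓ} {U : Theory S} {X : Met ℓ} (F : FreeModel U X) (B : Model U) →
  (h k : Hom (FreeModel.model F) B) →
  fun h ∙ FreeModel.unit F ≗ fun k ∙ FreeModel.unit F → fun h ≗ fun k
hom-ext F B h k p u = Model.≈-trans B
  (F.ext-unique B (fun k ∙ F.unit) h p u)
  (Model.≈-sym B (F.ext-unique B (fun k ∙ F.unit) k (λ _ → Model.≈-refl B) u))
  where module F = FreeModel F

module _ {S : Signature ℓ} {U : Theory S} {M : Monad ℓ} (L : LiftsFreely U M)
  (F : ∀ X → FreeModel U X) where
  private
    module M = Monad M
    module L = LiftsFreely L
    module F X = FreeModel (F X)
    module I = Monad (inducedMonad F)

    φ : ∀ X → Hom (L.model X) (F.model X)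
    φ X = L.ext (F.model X) (F.unit X)

    φ-η : ∀ X → fun (φ X) ∙ M.η X ≗ F.unit X
    φ-η X = L.ext-η (F.model X) (F.unit X)

    φ⁻¹ : ∀ X → Hom (F.model X) (L.model X)
    φ⁻¹ X = F.ext X (L.model X) (M.η X)

    φ⁻¹-η : ∀ X → fun (φ⁻¹ X) ∙ F.unit X ≗ M.η X
    φ⁻¹-η X = F.ext-unit X (L.model X) (M.η X)

    -- `T₁ᶠ` and `μᶠ` are the functor action and the multiplication of `inducedMonad F`, with the
    -- homomorphism structure that the monad forgets.
    T₁ᶠ : ∀ {X Y} → X ⇒ Y → Hom (F.model X) (F.model Y)
    T₁ᶠ {X} {Y} f = F.ext X (F.model Y) (F.unit Y ∙ f)

    μᶠ : ∀ X → Hom (F.model (F.space X)) (F.model X)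
    μᶠ X = F.ext (F.space X) (F.model X) (idM (F.space X))

  -- Apart from `preserves-η`, each equation compares two homomorphisms out of a free model, so it
  -- is checked on generators. `T₁-preserves` and `μ-preserves` make this possible for naturality
  -- and for the multiplication.
  liftsFreely⇒≅ : M ≅ inducedMonad F
  liftsFreely⇒≅ = record
    { φ        = λ X → fun (φ X)
    ; φ⁻¹      = λ X → fun (φ⁻¹ X)
    ; inverseˡ = λ X → hom-ext (F X) (F.model X) (φ X ∙ʰ φ⁻¹ X) (idHom (F.model X)) λ x →
        Met.≈-trans (F.space X) (to-cong (fun (φ X)) (φ⁻¹-η X x)) (φ-η X x)
    ; inverseʳ = λ X → L.η-epic (L.model X) (φ⁻¹ X ∙ʰ φ X) (idHom (L.model X)) λ x →
        Met.≈-trans (M.T₀ X) (to-cong (fun (φ⁻¹ X)) (φ-η X x)) (φ⁻¹-η X x)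
    ; natural  = λ {X} {Y} f →
        L.η-epic (F.model Y) (φ Y ∙ʰ L.T₁-hom f) (T₁ᶠ f ∙ʰ φ X) λ x →
          let open SetoidReasoning (Met.setoid (F.space Y)) in begin
          to (fun (φ Y)) (to (M.T₁ f) (to (M.η X) x)) ≈⟨ to-cong (fun (φ Y)) (M.η-natural f x) ⟩
          to (fun (φ Y)) (to (M.η Y) (to f x))        ≈⟨ φ-η Y (to f x) ⟩
          to (F.unit Y) (to f x)                      ≈⟨ I.η-natural f x ⟨
          to (I.T₁ f) (to (F.unit X) x)               ≈⟨ to-cong (I.T₁ f) (φ-η X x) ⟨
          to (I.T₁ f) (to (fun (φ X)) (to (M.η X) x)) ∎
    ; preserves-η = φ-η
    -- On a generator `η u` both sides become `φ u`: one by the unit law of `M`, the other by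
    -- naturality of `η` and the unit law of the induced monad.
    ; preserves-μ = λ X →
        L.η-epic (F.model X) (φ X ∙ʰ L.μ-hom X)
          (μᶠ X ∙ʰ (φ (F.space X) ∙ʰ L.T₁-hom (fun (φ X)))) λ u →
          let φᶠ = fun (φ (F.space X))
              open SetoidReasoning (Met.setoid (F.space X)) in begin
          to (fun (φ X)) (to (M.μ X) (to (M.η _) u))
            ≈⟨ to-cong (fun (φ X)) (M.identityˡ X u) ⟩
          to (fun (φ X)) u
            ≈⟨ I.identityˡ X _ ⟨
          to (I.μ X) (to (F.unit _) (to (fun (φ X)) u))
            ≈⟨ to-cong (I.μ X) (φ-η (F.space X) _) ⟨
          to (I.μ X) (to φᶠ (to (M.η _) (to (fun (φ X)) u)))
            ≈⟨ to-cong (I.μ X ∙ φᶠ) (M.η-natural (fun (φ X)) u) ⟨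
          to (I.μ X) (to φᶠ (to (M.T₁ (fun (φ X))) (to (M.η _) u))) ∎
    }

-- Models of the writer theory as non-expansive actions of the monoid.

module _ (Λ : MetricMonoid ℓ) where
  private
    module Λ = MetricMonoid Λ

  module _ (B : Model (Writer Λ)) where
    private
      module B = Model B

    -- The argument is a lookup, not a constant function, so that eval of w α t
    -- reduces to write α (eval t).
    write : Λ.Carrier → B.Carrier → B.Carrier
    write α b = to B.⟦ α ⟧ (lookup (b ∷ []))

    write-0# : ∀ b → b B.≈ write Λ.0# b
    write-0# b = B.d≼0⇒≈ (B.satisfies _ (axiom (unit 0)) (λ _ → b) λ _ ())

    write-* : ∀ α α′ b → write α (write α′ b) B.≈ write (α Λ.* α′) b
    write-* α α′ b = B.d≼0⇒≈ (B.satisfies _ (axiom (mult α α′ 0)) (λ _ → b) λ _ ())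

    -- Joint non-expansiveness comes from `diff`. That axiom needs rational bounds, and the sum
    -- metric provides `β` and `γ` with `β + γ ≤ δ` only for `δ > ε`, hence the passage to the limit
    -- by `closed`.
    writing : Λ.space □ B.space ⇒ B.space
    to           writing (α , b) = write α b
    nonexpansive writing (α , b) (α′ , b′) ε p =
      closed (B.d (write α b) (write α′ b′)) λ δ ε<δ →
        let β , γ , pβ , pγ , β+γ≤δ = p δ ε<δ in
        B.satisfies _
          (axiom (diff α α′ 0 1 γ δ λ ζ δ≤ζ →
            upward (Λ.d α α′ +∞ fromℚ≥0 γ) {β + γ} {ζ} (ℚ.≤-trans β+γ≤δ (lower δ≤ζ))
              (≼-+ (Λ.d α α′) (fromℚ≥0 γ) {β} {γ} pβ (lift ℚ.≤-refl))))
          (λ { 0 → b ; _ → b′ })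
          λ { _ (here refl) → pγ }

  module _ (A : Algebra (WriterSignature Λ)) where
    private
      module A = Algebra A

    -- The two action laws give `unit` and `mult`; non-expansiveness of `act` in both arguments
    -- together gives `diff`.
    satisfies-Writer : (act : Λ.space □ A.space ⇒ A.space) →
      (∀ α as → to A.⟦ α ⟧ as A.≈ to act (α , as zero)) →
      (∀ a → to act (Λ.0# , a) A.≈ a) →
      (∀ α β a → to act (α , to act (β , a)) A.≈ to act (α Λ.* β , a)) →
      ∀ φ → member (Writer Λ) φ → A.Satisfies φ
    satisfies-Writer act ⟦⟧≈act act-0# act-* = sound A λ where
      (unit x) ι p → A.≈⇒d≼ 0q (A.≈-sym (A.≈-trans (⟦⟧≈act Λ.0# _) (act-0# (ι x))))
      (mult α β x) ι p → A.≈⇒d≼ 0q (A.≈-trans (⟦⟧≈act α _)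
        (A.≈-trans (to-cong act (Λ.≈-refl , ⟦⟧≈act β _))
        (A.≈-trans (act-* α β (ι x)) (A.≈-sym (⟦⟧≈act (α Λ.* β) _)))))
      (diff α β x y ε δ d+ε≤δ) ι p →
        A.d-resp δ (A.≈-sym (⟦⟧≈act α _)) (A.≈-sym (⟦⟧≈act β _))
          (nonexpansive act (α , ι x) (β , ι y) δ
            (+∞-mono (Λ.d α β) (Λ.d α β) (A.d (ι x) (ι y)) (fromℚ≥0 ε) (λ _ q → q)
              (λ ζ ε≤ζ → upward (A.d (ι x) (ι y)) {ε} {ζ} (lower ε≤ζ) (p _ (here refl)))
              δ (d+ε≤δ δ (lift ℚ.≤-refl))))

-- The composite monad lifts freely to models of the tensor.

module _ (Λ : MetricMonoid ℓ) {S : Signature ℓ} (U : Theory S) where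
  private
    module Λ = MetricMonoid Λ
    module Mon = IsMonoid Λ.isMonoid
    module W = Monad (writerMonad Λ)
    module T = Monad (freeMonad U)
    module C = Monad (writerComposite U Λ)
    module D = DistributiveLaw (writerLaw (freeMonad U) Λ (freeMonad-strong U))
    open TermModel using (ext) renaming (model to term-model; freeModel to term-free)

    T₁-hom : ∀ {X Y} → X ⇒ Y → Hom (term-model U X) (term-model U Y)
    T₁-hom {X} {Y} f = ext U X (term-model U Y) (T.η Y ∙ f)

    μ-hom : ∀ X → Hom (term-model U (T.T₀ X)) (term-model U X)
    μ-hom X = ext U (T.T₀ X) (term-model U X) (idM (T.T₀ X))

    act : ∀ X → Λ.space □ C.T₀ X ⇒ C.T₀ X
    act X = T.T₁ (W.μ X) ∙ D.law (W.T₀ X)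

    -- For fixed `α` the strength is the functor applied to a pairing map, hence a homomorphism for
    -- the operations of `U`. Identities between actions can therefore be checked on generators,
    -- where they are the monoid laws.
    act-hom : ∀ X → Λ.Carrier → Hom (term-model U (W.T₀ X)) (term-model U (W.T₀ X))
    act-hom X α = T₁-hom (W.μ X) ∙ʰ T₁-hom (pair Λ.space (W.T₀ X) α)

    μᶜ-hom : ∀ X → Hom (term-model U (W.T₀ (C.T₀ X))) (term-model U (W.T₀ X))
    μᶜ-hom X = T₁-hom (W.μ X) ∙ʰ (μ-hom (W.T₀ (W.T₀ X)) ∙ʰ T₁-hom (D.law (W.T₀ X)))

    act-0# : ∀ X u → Met._≈_ (C.T₀ X) (to (act X) (Λ.0# , u)) u
    act-0# X = hom-ext (term-free U (W.T₀ X)) (term-model U (W.T₀ X))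
      (act-hom X Λ.0#) (idHom _)
      λ (β , x) → to-cong (T.η (W.T₀ X)) (Mon.identityˡ β , Met.≈-refl X)

    act-* : ∀ X α β u →
      Met._≈_ (C.T₀ X) (to (act X) (α , to (act X) (β , u))) (to (act X) (α Λ.* β , u))
    act-* X α β = hom-ext (term-free U (W.T₀ X)) (term-model U (W.T₀ X))
      (act-hom X α ∙ʰ act-hom X β) (act-hom X (α Λ.* β))
      λ (γ , x) → to-cong (T.η (W.T₀ X)) (Mon.sym (Mon.assoc α β γ) , Met.≈-refl X)

    algebra : ∀ X → Algebra (S ⊎ˢ WriterSignature Λ)
    algebra X = algebraOn (C.T₀ X) ⟦_⟧
      where
      ⟦_⟧ : ∀ f → C.T₀ X ^ arity (S ⊎ˢ WriterSignature Λ) f ⇒ C.T₀ X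
      ⟦ inj₁ f ⟧ = Model.⟦_⟧ (term-model U (W.T₀ X)) f
      ⟦ inj₂ α ⟧ = record
        { to           = λ us → to (act X) (α , us zero)
        ; nonexpansive = λ us vs ε p →
            nonexpansive (fun (act-hom X α)) (us zero) (vs zero) ε (p zero)
        }

    algebra-satisfies : ∀ X φ → member (U ⊗ Writer Λ) φ → Algebra.Satisfies (algebra X) φ
    algebra-satisfies X = satisfies-⊗ (algebra X) U (Writer Λ)
      (Model.satisfies (term-model U (W.T₀ X)))
      (satisfies-Writer Λ (reductʳ (algebra X)) (act X)
        (λ _ _ → Met.≈-refl (C.T₀ X)) (act-0# X) (act-* X))
      -- Since writing is unary, commutation with `f` says that the action of `α` is a homomorphism
      -- for `f`.
      λ f α a → Met.≈-sym (C.T₀ X) (preserves (act-hom X α) f (λ i → a i zero))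

    module _ {X : Met ℓ} (B : Model (U ⊗ Writer Λ)) where
      private
        module B = Model B

      write-hom : Λ.Carrier → Hom (modelˡ B) (modelˡ B)
      write-hom α = record
        { fun = writing Λ (modelʳ B) ∙ pair Λ.space B.space α
        ; preserves = λ f bs →
            -- The one-entry argument families agree only pointwise, so the case `zero` is matched
            -- before the commutation axiom applies.
            B.≈-trans (to-cong B.⟦ inj₂ α ⟧ λ { zero → B.≈-refl })
              (B.≈-sym (commutes B f α (λ i → lookup (bs i ∷ []))))
        }

      ext-⊗ : X ⇒ B.space → Hom (term-model U (W.T₀ X)) (modelˡ B)
      ext-⊗ f = ext U (W.T₀ X) (modelˡ B) (writing Λ (modelʳ B) ∙ W.T₁ f)

      ext-⊗-act : ∀ f α u →
        to (fun (ext-⊗ f)) (to (act X) (α , u)) B.≈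
        write Λ (modelʳ B) α (to (fun (ext-⊗ f)) u)
      ext-⊗-act f α = hom-ext (term-free U (W.T₀ X)) (modelˡ B)
        (ext-⊗ f ∙ʰ act-hom X α) (write-hom α ∙ʰ ext-⊗ f)
        λ (β , x) → B.≈-sym (write-* Λ (modelʳ B) α β (to f x))

    model : ∀ X → Model (U ⊗ Writer Λ)
    model X = record { algebra = algebra X ; satisfies = algebra-satisfies X }

    -- The action of `α` on `η (0 , x)` computes to `η (α * 0 , x)`, so the right unit law applies.
    -- This reduces agreement on the generators `(α , x)` to agreement on the unit of the composite.
    hom-η : ∀ {X} (B : Model (U ⊗ Writer Λ)) (h : Hom (model X) B) α x →
      Model._≈_ B (to (fun h) (to (T.η (W.T₀ X)) (α , x)))
        (to (Model.⟦_⟧ B (inj₂ α)) λ _ → to (fun h) (to (C.η X) x))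
    hom-η {X} B h α x = Model.≈-trans B
      (to-cong (fun h ∙ T.η (W.T₀ X)) (Mon.sym (Mon.identityʳ α) , Met.≈-refl X))
      (preserves h (inj₂ α) (λ _ → to (C.η X) x))

  composite-liftsFreely : LiftsFreely (U ⊗ Writer Λ) (writerComposite U Λ)
  composite-liftsFreely = record
    { operation    = λ X → Algebra.⟦_⟧ (algebra X)
    ; satisfies    = algebra-satisfies
    ; T₁-preserves = λ where
        f (inj₁ g) us → preserves (T₁-hom (W.T₁ f)) g us
        {X} {Y} f (inj₂ α) us → hom-ext (term-free U (W.T₀ X)) (term-model U (W.T₀ Y))
          (T₁-hom (W.T₁ f) ∙ʰ act-hom X α) (act-hom Y α ∙ʰ T₁-hom (W.T₁ f))
          (λ _ → Met.≈-refl (C.T₀ Y)) (us zero)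
    ; μ-preserves  = λ where
        X (inj₁ g) us → preserves (μᶜ-hom X) g us
        X (inj₂ α) us → hom-ext (term-free U (W.T₀ (C.T₀ X))) (term-model U (W.T₀ X))
          (μᶜ-hom X ∙ʰ act-hom (C.T₀ X) α) (act-hom X α ∙ʰ μᶜ-hom X)
          -- The composite multiplication sends the generator `(β , u)` to the action of `β` on `u`,
          -- so compatibility with writing is associativity of the action.
          (λ (β , u) → Met.≈-sym (C.T₀ X) (act-* X α β u)) (us zero)
    ; ext          = λ B f → record
        { fun = fun (ext-⊗ B f)
        ; preserves = λ where
            (inj₁ g) us → preserves (ext-⊗ B f) g us
            (inj₂ α) us → Model.≈-trans B (ext-⊗-act B f α (us zero))
              (to-cong (Model.⟦_⟧ B (inj₂ α)) λ { zero → Model.≈-refl B })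
        }
    ; ext-η        = λ B f x → Model.≈-sym B (write-0# Λ (modelʳ B) (to f x))
    ; η-epic       = λ {X} B h k p → hom-ext (term-free U (W.T₀ X)) (modelˡ B)
        (record { fun = fun h ; preserves = preserves h ∘ inj₁ })
        (record { fun = fun k ; preserves = preserves k ∘ inj₁ })
        λ (α , x) → Model.≈-trans B (hom-η B h α x)
          (Model.≈-trans B (to-cong (Model.⟦_⟧ B (inj₂ α)) λ _ → p x)
            (Model.≈-sym B (hom-η B k α x)))
    }

corollary6p22 : ∀ {ℓ} (Λ : MetricMonoid ℓ) {S : Signature ℓ} (U : Theory S) →
    Basic U → writerComposite U Λ ≅ freeMonad (U ⊗ Writer Λ)
corollary6p22 Λ U _ =
  liftsFreely⇒≅ (composite-liftsFreely Λ U) (TermModel.freeModel (U ⊗ Writer Λ))
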